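{- There is a large enough constant $C>0$ such that the following holds. Let $f\colon\{0,1\}^n\to\{0,1\}$ and $g\colon\{0,1\}^m\to\{0,1\}$ be Boolean functions, let $t\geq C\log n$, and let $\mathsf{Amp}_t\colon\{0,1\}^t\to\{0,1\}$ be any Boolean function with full sign degree. Then $\widetilde{\deg}(f\circ g)=\Omega(\widetilde{\deg}(f)\,\widetilde{\deg}(g))$ whenever $f=\mathsf{Amp}_t^d$ (and $g$ is arbitrary) or $g=\mathsf{Amp}_t^d$ (and $f$ is arbitrary), for a positive integer $d$.
   Context: For Boolean $F$ on $a$ bits and $G$ on $b$ bits, $F\circ G(x_1,\dots,x_a)=F(G(x_1),\dots,G(x_a))$; $F^d$ is $F$ composed with itself $d$ times. $\widetilde{\deg}(F)$ is the minimum degree of a real polynomial $p$ with $|p(x)-F(x)|\leq 1/3$ on all Boolean inputs. The sign degree of $F$ is the minimum degree of a real polynomial $p$ with $(1-2F(x))p(x)>0$ for all Boolean $x$; full sign degree means sign degree equal to the number of input bits $t$.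
   Formalization: Approximate degree and sign degree are defined with polynomials having rational rather than real coefficients; the degrees coincide because a finite linear system with rational data is solvable over the reals exactly when it is solvable over the rationals. -}

module Defs where

open import Data.Bool using (Bool; true; false; if_then_else_)
open import Data.Nat using (ℕ; zero; suc; _^_; _*_)
import Data.Nat as ℕ
open import Data.Fin using (Fin; zero; suc; combine)
open import Data.Fin.Subset using (Subset) renaming (∣_∣ to size)
open import Data.Vec using (_∷_; [])
open import Data.List using (List; foldr)
open import Data.List.Relation.Unary.All using (All)
open import Data.Product using (_×_; _,_; proj₁; proj₂; Σ; ∃)
open import Data.Integer using (+_; -[1+_])
open import Data.Rational using (ℚ; 0ℚ; 1ℚ; _+_; _-_; _≤_; _<_; ∣_∣)
import Data.Rational as ℚ

BoolFn : ℕ → Set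
BoolFn n = (Fin n → Bool) → Bool

_⊚_ : ∀ {a b} → BoolFn a → BoolFn b → BoolFn (a * b)
(F ⊚ G) x = F (λ i → G (λ j → x (combine i j)))

_^^_ : ∀ {t} → BoolFn t → (d : ℕ) → BoolFn (t ^ d)
(F ^^ zero) x = x zero
(F ^^ suc d) = F ⊚ (F ^^ d)

⟦_⟧ : Bool → ℚ
⟦ true ⟧ = 1ℚ
⟦ false ⟧ = 0ℚ

-- Polynomials over ℚ on n Boolean variables, as a list of monomials
-- (coefficient, set of variables).  (On Boolean inputs x_i^2 = x_i, so
-- multilinear monomials suffice.)
Poly : ℕ → Set
Poly n = List (ℚ × Subset n)

monoEval : ∀ {n} → Subset n → (Fin n → Bool) → ℚ
monoEval {zero} [] x = 1ℚ
monoEval {suc n} (b ∷ S) x =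
  (if b then ⟦ x zero ⟧ else 1ℚ) ℚ.* monoEval S (λ i → x (suc i))

eval : ∀ {n} → Poly n → (Fin n → Bool) → ℚ
eval p x = foldr (λ m acc → proj₁ m ℚ.* monoEval (proj₂ m) x + acc) 0ℚ p

DegLe : ∀ {n} → Poly n → ℕ → Set
DegLe p D = All (λ m → size (proj₂ m) ℕ.≤ D) p

oneThird : ℚ
oneThird = + 1 ℚ./ 3

Approximates : ∀ {n} → Poly n → BoolFn n → Set
Approximates p F = ∀ x → ∣ eval p x - ⟦ F x ⟧ ∣ ≤ oneThird

IsApproxDeg : ∀ {n} → BoolFn n → ℕ → Set
IsApproxDeg {n} F k =
  (Σ (Poly n) λ p → DegLe p k × Approximates p F)
  × (∀ (p : Poly n) (D : ℕ) → DegLe p D → Approximates p F → k ℕ.≤ D)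

pm : Bool → ℚ
pm true = -[1+ 0 ] ℚ./ 1
pm false = 1ℚ

SignRepresents : ∀ {n} → Poly n → BoolFn n → Set
SignRepresents p F = ∀ x → 0ℚ < pm (F x) ℚ.* eval p x

IsSignDeg : ∀ {n} → BoolFn n → ℕ → Set
IsSignDeg {n} F k =
  (Σ (Poly n) λ p → DegLe p k × SignRepresents p F)
  × (∀ (p : Poly n) (D : ℕ) → DegLe p D → SignRepresents p F → k ℕ.≤ D)

FullSignDeg : ∀ {t} → BoolFn t → Set
FullSignDeg {t} F = IsSignDeg F t

ℕtoℚ : ℕ → ℚ
ℕtoℚ k = + k ℚ./ 1

{-# OPTIONS --safe #-}

-- A function F of full sign degree t is ±χ for the character χ = Π (−1)^{x_i}: otherwise
-- F − c χ, with c the coefficient of χ in ±F, has degree below t and the sign of F.  Hence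
-- Amp^d is a parity of N = t^d bits, up to negation, and its approximate degree is at most N.
--
-- Inner parity: averaging an approximant of f ∘ XOR_N over the fibres of the N-bit parities kills
-- every monomial that meets a block properly, which divides the degree by N.
--
-- Outer parity (a direct-sum argument for XOR_N ∘ g in the style of Sherstov): if ±g has no
-- polynomial of degree k with values in [1/63, 1], then linear programming duality gives a
-- probability measure μ and a splitting g μ = ψ + φ with ψ orthogonal to degree ≤ k and
-- ‖φ‖ ≤ 1/32.  Expand (g μ)^{⊗N}.  Terms with at least N/2 factors φ have total norm at most
-- 2^N / 32^{N/2}, and the others annihilate polynomials of degree below (N/2)(k + 1), so no
-- such polynomial approximates XOR_N ∘ g.  An odd polynomial of constant degree amplifies
-- [1/63, 1] to [1/3, 1], so k can be taken proportional to the approximate degree of g.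
module Submission where

open import Defs
open import Algebra.Bundles using (CommutativeRing)
open import Data.Bool using (Bool; true; false; not; T; _∧_; _∨_; _xor_; if_then_else_)
open import Data.Bool.Properties using (T-∧; not-involutive; xor-assoc; xor-same; xor-∧-commutativeRing)
open import Algebra.Properties.CommutativeSemigroup (CommutativeRing.+-commutativeSemigroup xor-∧-commutativeRing) using (interchange)
open import Data.Empty using (⊥; ⊥-elim)
open import Data.Fin using (Fin; zero; suc; combine; _↑ˡ_; _↑ʳ_)
open import Data.Fin.Subset using (Subset; _∪_) renaming (⊥ to ∅; ∣_∣ to size)
open import Data.Fin.Subset.Properties using (anySubset?) renaming (∣⊥∣≡0 to ∣∅∣≡0)
import Data.Integer as ℤ
import Data.Integer.Properties as ℤ
open import Data.List using (List; []; _∷_; _++_; map; foldr)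
open import Data.List.Membership.Propositional using (_∈_)
open import Data.List.Membership.Propositional.Properties using (∈-map⁺; ∈-++⁺ˡ; ∈-++⁺ʳ)
open import Data.List.Relation.Unary.All as All using (All; []; _∷_)
open import Data.List.Relation.Unary.All.Properties using () renaming (++⁺ to All-++⁺)
open import Data.List.Relation.Unary.Any using (here; there)
open import Data.Maybe using (Maybe; just; nothing)
open import Data.Nat as ℕ using (zero; suc; z≤n; s≤s; ⌊_/2⌋; ⌈_/2⌉)
import Data.Nat.DivMod as ℕ
import Data.Nat.Properties as ℕ
open import Data.Nat.Tactic.RingSolver using () renaming (solve-∀ to solve-ℕ)
open import Data.Product using (∃; _,_; proj₁; proj₂; map₁)
import Data.Rational.Unnormalised as ℚᵘ
import Data.Rational.Unnormalised.Properties as ℚᵘ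
open import Data.Sum using (_⊎_; inj₁; inj₂; [_,_]′)
open import Data.Unit using (⊤; tt)
open import Data.Vec using (Vec; []; _∷_; head; tail; lookup; tabulate) renaming (_++_ to _++ᵛ_; splitAt to splitAtᵛ)
open import Data.Vec.Properties using (lookup∘tabulate)
open import Function using (_∘_)
open import Function.Bundles using (Equivalence)
open import Level using (0ℓ)
open import Relation.Binary.Definitions using (tri<; tri≈; tri>)
open import Relation.Binary.PropositionalEquality
open import Relation.Nullary using (Dec; yes; no; ¬?; _×-dec_; decidable-stable)
open import Relation.Nullary.Decidable using (dec⇒maybe)
open import Tactic.RingSolver using (solve-∀)
open import Tactic.RingSolver.Core.AlmostCommutativeRing using (AlmostCommutativeRing; fromCommutativeRing)
open import Data.Nat using (ℕ)
open import Data.Product using (Σ; _×_)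
open import Data.Rational using (ℚ; 0ℚ)

-- The choice of 1/63 comes from the tensor power. If values in [1/R, 1] are excluded, duality
-- bounds ‖φ‖ by 2/(R + 1). For R = 3, which corresponds to approximation within 1/3, this is only
-- 1/2, and 2^N / 2^{N/2} gives nothing. An approximant rescaled to ±1 values correlates with the
-- parity by at least 1/3 and is bounded by 5/3, so an error of 1/8 suffices: 5/24 < 1/3. All
-- arithmetic is rational and all systems are finite, so duality is proved by elimination, with no
-- compactness argument. The scale of the polynomial is kept as an extra unknown, which makes the
-- system homogeneous. Points of the cube are functions and the Boolean functions on them are
-- arbitrary. That these respect pointwise equality is extracted from the polynomials that
-- approximate or sign-represent them.

-- Finite formal sums with rational weights.

module FormalSums where

  open import Data.Rational
  open import Data.Rational.Properties

  ℚ-ring : AlmostCommutativeRing 0ℓ 0ℓ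
  ℚ-ring = fromCommutativeRing +-*-commutativeRing (λ x → dec⇒maybe (0ℚ ≟ x))

  ≤-by-gap : ∀ {x y} z → 0ℚ ≤ z → y ≡ x + z → x ≤ y
  ≤-by-gap {x} z 0≤z refl = subst (_≤ x + z) (+-identityʳ x) (+-monoʳ-≤ x 0≤z)

  <-by-gap : ∀ {x y} z → 0ℚ < z → y ≡ x + z → x < y
  <-by-gap {x} z 0<z refl = subst (_< x + z) (+-identityʳ x) (+-monoʳ-< x 0<z)

  0≤+ : ∀ {x y} → 0ℚ ≤ x → 0ℚ ≤ y → 0ℚ ≤ x + y
  0≤+ = +-mono-≤

  0≤* : ∀ {x y} → 0ℚ ≤ x → 0ℚ ≤ y → 0ℚ ≤ x * y
  0≤* {x} {y} 0≤x 0≤y =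
    nonNegative⁻¹ (x * y) {{nonNeg*nonNeg⇒nonNeg x {{nonNegative 0≤x}} y {{nonNegative 0≤y}}}}

  0<* : ∀ {x y} → 0ℚ < x → 0ℚ < y → 0ℚ < x * y
  0<* {x} {y} 0<x 0<y =
    positive⁻¹ (x * y) {{pos*pos⇒pos x {{positive 0<x}} y {{positive 0<y}}}}

  x≤y⇒0≤y-x : ∀ {x y} → x ≤ y → 0ℚ ≤ y - x
  x≤y⇒0≤y-x {x} {y} x≤y = subst (_≤ y - x) (+-inverseʳ x) (+-monoˡ-≤ (- x) x≤y)

  x<y⇒0<y-x : ∀ {x y} → x < y → 0ℚ < y - x
  x<y⇒0<y-x {x} {y} x<y = subst (_< y - x) (+-inverseʳ x) (+-monoˡ-< (- x) x<y)

  p≤∣p∣ : ∀ p → p ≤ ∣ p ∣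
  p≤∣p∣ p with ≤-total 0ℚ p
  ... | inj₁ 0≤p = ≤-reflexive (sym (0≤p⇒∣p∣≡p 0≤p))
  ... | inj₂ p≤0 = ≤-trans p≤0 (0≤∣p∣ p)

  -p≤∣p∣ : ∀ p → - p ≤ ∣ p ∣
  -p≤∣p∣ p = subst (- p ≤_) (∣-p∣≡∣p∣ p) (p≤∣p∣ (- p))

  ∣p∣≤q : ∀ {p q} → p ≤ q → - p ≤ q → ∣ p ∣ ≤ q
  ∣p∣≤q {p} p≤q -p≤q with ∣p∣≡p∨∣p∣≡-p p
  ... | inj₁ e = subst (_≤ _) (sym e) p≤q
  ... | inj₂ e = subst (_≤ _) (sym e) -p≤q

  -- The same type serves polynomials, vectors of unknowns and finite measures. `eval p x` is `∫ p`
  -- of the monomials at x by definition, so every law of `∫` applies to polynomials directly.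
  FormalSum : Set → Set
  FormalSum A = List (ℚ × A)

  module _ {A : Set} where

    ∫ : FormalSum A → (A → ℚ) → ℚ
    ∫ w f = foldr (λ m acc → proj₁ m * f (proj₂ m) + acc) 0ℚ w

    scale : ℚ → FormalSum A → FormalSum A
    scale c = map (map₁ (c *_))

    NonNegWeights : FormalSum A → Set
    NonNegWeights = All (λ m → 0ℚ ≤ proj₁ m)

    ∫-congAll : ∀ {w f g} → All (λ m → f (proj₂ m) ≡ g (proj₂ m)) w → ∫ w f ≡ ∫ w g
    ∫-congAll [] = refl
    ∫-congAll {(c , a) ∷ w} (e ∷ es) = cong₂ (λ u v → c * u + v) e (∫-congAll es)

    ∫-cong : ∀ w {f g} → (∀ a → f a ≡ g a) → ∫ w f ≡ ∫ w g
    ∫-cong w e = ∫-congAll (All.universal (λ m → e (proj₂ m)) w)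

    ∫-+ : ∀ w f g → ∫ w (λ a → f a + g a) ≡ ∫ w f + ∫ w g
    ∫-+ [] f g = refl
    ∫-+ ((c , a) ∷ w) f g = trans (cong (c * (f a + g a) +_) (∫-+ w f g)) (ring c (f a) (g a) _ _)
      where
      ring : ∀ c x y u v → c * (x + y) + (u + v) ≡ (c * x + u) + (c * y + v)
      ring = solve-∀ ℚ-ring

    ∫-* : ∀ w c f → ∫ w (λ a → c * f a) ≡ c * ∫ w f
    ∫-* [] c f = sym (*-zeroʳ c)
    ∫-* ((b , a) ∷ w) c f = trans (cong (b * (c * f a) +_) (∫-* w c f)) (ring b c (f a) _)
      where
      ring : ∀ b c x u → b * (c * x) + c * u ≡ c * (b * x + u)
      ring = solve-∀ ℚ-ring

    ∫-zero : ∀ {w f} → All (λ m → f (proj₂ m) ≡ 0ℚ) w → ∫ w f ≡ 0ℚ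
    ∫-zero [] = refl
    ∫-zero {(c , a) ∷ w} (e ∷ es) = trans (cong₂ (λ u v → c * u + v) e (∫-zero es)) (ring c)
      where
      ring : ∀ c → c * 0ℚ + 0ℚ ≡ 0ℚ
      ring = solve-∀ ℚ-ring

    ∫-++ : ∀ v w f → ∫ (v ++ w) f ≡ ∫ v f + ∫ w f
    ∫-++ [] w f = sym (+-identityˡ _)
    ∫-++ ((c , a) ∷ v) w f = trans (cong (c * f a +_) (∫-++ v w f)) (sym (+-assoc (c * f a) (∫ v f) (∫ w f)))

    ∫-scale : ∀ c w f → ∫ (scale c w) f ≡ c * ∫ w f
    ∫-scale c [] f = sym (*-zeroʳ c)
    ∫-scale c ((b , a) ∷ w) f = trans (cong (c * b * f a +_) (∫-scale c w f)) (ring c b (f a) _)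
      where
      ring : ∀ c b x u → c * b * x + c * u ≡ c * (b * x + u)
      ring = solve-∀ ℚ-ring

    ∫-mono : ∀ {w f g} → NonNegWeights w → (∀ a → f a ≤ g a) → ∫ w f ≤ ∫ w g
    ∫-mono [] f≤g = ≤-refl
    ∫-mono {(c , a) ∷ w} (0≤c ∷ cs) f≤g =
      +-mono-≤ (*-monoˡ-≤-nonNeg c {{nonNegative 0≤c}} (f≤g a)) (∫-mono cs f≤g)

    scale-nonNeg : ∀ {c w} → 0ℚ ≤ c → NonNegWeights w → NonNegWeights (scale c w)
    scale-nonNeg 0≤c [] = []
    scale-nonNeg 0≤c (0≤b ∷ bs) = 0≤* 0≤c 0≤b ∷ scale-nonNeg 0≤c bs

    scale-All : ∀ {P : A → Set} c {w} → All (λ m → P (proj₂ m)) w → All (λ m → P (proj₂ m)) (scale c w)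
    scale-All c [] = []
    scale-All c (p ∷ ps) = p ∷ scale-All c ps

  ∫-swap : ∀ {A B : Set} (v : FormalSum A) (w : FormalSum B) (f : A → B → ℚ) →
           ∫ v (λ a → ∫ w (f a)) ≡ ∫ w (λ b → ∫ v (λ a → f a b))
  ∫-swap [] w f = sym (∫-zero (All.universal (λ _ → refl) w))
  ∫-swap ((c , a) ∷ v) w f = trans
    (cong₂ _+_ (sym (∫-* w c (f a))) (∫-swap v w f))
    (sym (∫-+ w (λ b → c * f a b) (λ b → ∫ v (λ a → f a b))))

open FormalSums

-- Gordan's theorem of the alternative over ℚ.

module LinearAlternative where

  open import Data.Rational
  open import Data.Rational.Properties

  0<square : ∀ x → x ≢ 0ℚ → 0ℚ < x * x
  0<square x x≢0 with <-cmp 0ℚ x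
  ... | tri< 0<x _ _ = 0<* 0<x 0<x
  ... | tri≈ _ 0≡x _ with () ← x≢0 (sym 0≡x)
  ... | tri> _ _ x<0 = subst (0ℚ <_) (ring x) (0<* 0<-x 0<-x)
    where
    0<-x : 0ℚ < - x
    0<-x = neg-antimono-< x<0
    ring : ∀ x → (- x) * (- x) ≡ x * x
    ring = solve-∀ ℚ-ring

  -- With s = (∣β∣ + 1) / α the sum is ∣β∣ + β + 1, which is at least 1.
  dominate : ∀ α β → 0ℚ < α → Σ ℚ λ s → 0ℚ ≤ s × 0ℚ < s * α + β
  dominate α β 0<α = (∣ β ∣ + 1ℚ) * α⁻¹ , 0≤* (0≤+ (0≤∣p∣ β) (<⇒≤ 0<1)) (<⇒≤ 0<α⁻¹) ,
    <-by-gap (∣ β ∣ + β + 1ℚ)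
      (+-mono-≤-< (subst (_≤ ∣ β ∣ + β) (+-inverseˡ β) (+-monoˡ-≤ β (-p≤∣p∣ β))) 0<1)
      (trans (ring ∣ β ∣ β α⁻¹ α) (trans (cong (λ u → (∣ β ∣ + 1ℚ) * u + β) (*-inverseˡ α)) (ring′ ∣ β ∣ β)))
    where
    instance
      α-pos : Positive α
      α-pos = positive 0<α
      α-nonZero : NonZero α
      α-nonZero = pos⇒nonZero α
    α⁻¹ : ℚ
    α⁻¹ = 1/ α
    0<1 : 0ℚ < 1ℚ
    0<1 = positive⁻¹ 1ℚ
    0<α⁻¹ : 0ℚ < α⁻¹
    0<α⁻¹ = positive⁻¹ α⁻¹ {{1/pos⇒pos α}}
    ring : ∀ b β i a → (b + 1ℚ) * i * a + β ≡ (b + 1ℚ) * (i * a) + β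
    ring = solve-∀ ℚ-ring
    ring′ : ∀ b β → (b + 1ℚ) * 1ℚ + β ≡ 0ℚ + (b + β + 1ℚ)
    ring′ = solve-∀ ℚ-ring

  dominate-raise : ∀ {s t} a b → s ≤ t → 0ℚ ≤ a → 0ℚ < s * a + b → 0ℚ < t * a + b
  dominate-raise a b s≤t 0≤a 0<sab =
    <-≤-trans 0<sab (+-monoˡ-≤ b (*-monoʳ-≤-nonNeg a {{nonNegative 0≤a}} s≤t))

  dominateAll : ∀ {I : Set} (a b : I → ℚ) {is} → All (λ i → 0ℚ < a i) is →
                Σ ℚ λ s → 0ℚ ≤ s × All (λ i → 0ℚ < s * a i + b i) is
  dominateAll a b [] = 0ℚ , ≤-refl , []
  dominateAll {I} a b {i ∷ is} (0<a ∷ as) = both (dominate (a i) (b i) 0<a) (dominateAll a b as)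
    where
    Dominates : ℚ → I → Set
    Dominates s k = 0ℚ < s * a k + b k
    both : (Σ ℚ λ s → 0ℚ ≤ s × Dominates s i) → (Σ ℚ λ t → 0ℚ ≤ t × All (Dominates t) is) →
           Σ ℚ λ s → 0ℚ ≤ s × All (Dominates s) (i ∷ is)
    -- The sum of two nonnegative thresholds is above each of them, and domination persists when the
    -- threshold is raised.
    both (s , 0≤s , d) (t , 0≤t , ds) = s + t , 0≤+ 0≤s 0≤t ,
      dominate-raise {s} (a i) (b i) (≤-by-gap {s} t 0≤t refl) (<⇒≤ 0<a) d ∷
      All.zipWith (λ {k} (0<ak , dk) → dominate-raise {t} (a k) (b k) (≤-by-gap {t} s 0≤s (+-comm s t)) (<⇒≤ 0<ak) dk)
        (as , ds)

  -- Gordan's alternative for the finite system row i · p > 0, where p ranges over the formal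
  -- sums supported on Q.  Induction on the number of rows: if a solution x of the other rows
  -- violates row i, eliminate row i by projecting the other rows along it onto the hyperplane
  -- of functionals vanishing at x.
  module Gordan {I J : Set} (Q : J → Set)
    (search : (r : J → ℚ) → (∃ λ j → Q j × r j ≢ 0ℚ) ⊎ (∀ j → Q j → r j ≡ 0ℚ)) where

    Solution : List I → (I → J → ℚ) → Set
    Solution is row = Σ (FormalSum J) λ p → All (λ m → Q (proj₂ m)) p × All (λ i → 0ℚ < ∫ p (row i)) is

    Certificate : List I → (I → J → ℚ) → Set
    Certificate is row = Σ (FormalSum I) λ w → NonNegWeights w × All (λ m → proj₂ m ∈ is) w
      × 0ℚ < ∫ w (λ _ → 1ℚ) × (∀ j → Q j → ∫ w (λ i → row i j) ≡ 0ℚ)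

    -- A large multiple of z keeps the rows in `is` positive whatever v contributes there, while row
    -- i sees only v because it vanishes at z.
    perturb : ∀ {i is} row {z v} → All (λ m → Q (proj₂ m)) z → All (λ m → Q (proj₂ m)) v →
              All (λ k → 0ℚ < ∫ z (row k)) is → ∫ z (row i) ≡ 0ℚ → 0ℚ < ∫ v (row i) →
              Solution (i ∷ is) row
    perturb {i} {is} row {z} {v} Qz Qv zs z0 0<v =
      from-scale (dominateAll (λ k → ∫ z (row k)) (λ k → ∫ v (row k)) zs)
      where
      value : ∀ s k → ∫ (scale s z ++ v) (row k) ≡ s * ∫ z (row k) + ∫ v (row k)
      value s k = trans (∫-++ (scale s z) v (row k)) (cong (_+ ∫ v (row k)) (∫-scale s z (row k)))
      ring : ∀ s u → s * 0ℚ + u ≡ u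
      ring = solve-∀ ℚ-ring
      from-scale : (Σ ℚ λ s → 0ℚ ≤ s × All (λ k → 0ℚ < s * ∫ z (row k) + ∫ v (row k)) is) →
                   Solution (i ∷ is) row
      from-scale (s , _ , ds) = scale s z ++ v , All-++⁺ (scale-All s Qz) Qv ,
        subst (0ℚ <_) (sym (trans (value s i) (trans (cong (λ u → s * u + ∫ v (row i)) z0) (ring s _)))) 0<v ∷
        All.map (λ {k} → subst (0ℚ <_) (sym (value s k))) ds

    project : I → (I → J → ℚ) → FormalSum J → I → J → ℚ
    project i row x k j = (- ∫ x (row i)) * row k j + ∫ x (row k) * row i j

    -- The combination y = -ρ z + ζ x is the one on which row i vanishes, and on y the row k takes
    -- the value of the projected row at z. Since row i is negative at x, the direction -x repairs
    -- row i.
    lift-solution : ∀ {i is} row {x} → All (λ m → Q (proj₂ m)) x → ∫ x (row i) < 0ℚ →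
                    Solution is (project i row x) → Solution (i ∷ is) row
    lift-solution {i} row {x} Qx x<0 (z , Qz , zs) =
      perturb row {y} {scale (- 1ℚ) x}
        (All-++⁺ (scale-All (- ρ) Qz) (scale-All ζ Qx)) (scale-All (- 1ℚ) Qx)
        (All.map (λ {k} → subst (0ℚ <_) (trans (at-projected k) (sym (value k)))) zs)
        (trans (value i) (ring ρ ζ))
        (subst (0ℚ <_) (trans (ring-neg ρ) (sym (∫-scale (- 1ℚ) x (row i)))) (neg-antimono-< x<0))
      where
      ρ ζ : ℚ
      ρ = ∫ x (row i)
      ζ = ∫ z (row i)
      y : FormalSum J
      y = scale (- ρ) z ++ scale ζ x
      at-projected : ∀ k → ∫ z (project i row x k) ≡ (- ρ) * ∫ z (row k) + ζ * ∫ x (row k)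
      at-projected k = trans (∫-+ z (λ j → (- ρ) * row k j) (λ j → ∫ x (row k) * row i j))
        (cong₂ _+_ (∫-* z (- ρ) (row k)) (trans (∫-* z (∫ x (row k)) (row i)) (*-comm (∫ x (row k)) ζ)))
      value : ∀ k → ∫ y (row k) ≡ (- ρ) * ∫ z (row k) + ζ * ∫ x (row k)
      value k = trans (∫-++ (scale (- ρ) z) (scale ζ x) (row k))
        (cong₂ _+_ (∫-scale (- ρ) z (row k)) (∫-scale ζ x (row k)))
      ring : ∀ ρ ζ → (- ρ) * ζ + ζ * ρ ≡ 0ℚ
      ring = solve-∀ ℚ-ring
      ring-neg : ∀ ρ → - ρ ≡ (- 1ℚ) * ρ
      ring-neg = solve-∀ ℚ-ring

    -- Expanding the projected rows gives each old row the weight -ρ w and collects θ on row i. The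
    -- sign of θ is right because x satisfies every other row.
    lift-certificate : ∀ {i is} row {x} → All (λ k → 0ℚ < ∫ x (row k)) is → ∫ x (row i) < 0ℚ →
                       Certificate is (project i row x) → Certificate (i ∷ is) row
    lift-certificate {i} {is} row {x} xs x<0 (w , w≥0 , w∈is , 0<w , w⊥) =
      (θ , i) ∷ scale (- ρ) w ,
      0≤θ ∷ scale-nonNeg (<⇒≤ 0<-ρ) w≥0 ,
      here refl ∷ All.map there (scale-All (- ρ) w∈is) ,
      subst (0ℚ <_) (cong₂ _+_ (sym (*-identityʳ θ)) (sym (∫-scale (- ρ) w (λ _ → 1ℚ))))
        (+-mono-≤-< 0≤θ (0<* 0<-ρ 0<w)) ,
      orthogonal
      where
      ρ θ : ℚ
      ρ = ∫ x (row i)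
      θ = ∫ w (λ k → ∫ x (row k))
      0<-ρ : 0ℚ < - ρ
      0<-ρ = neg-antimono-< x<0
      nonneg : ∀ {v} → NonNegWeights v → All (λ m → proj₂ m ∈ is) v → 0ℚ ≤ ∫ v (λ k → ∫ x (row k))
      nonneg [] [] = ≤-refl
      nonneg (0≤c ∷ cs) (k∈is ∷ ks) = 0≤+ (0≤* 0≤c (<⇒≤ (All.lookup xs k∈is))) (nonneg cs ks)
      0≤θ : 0ℚ ≤ θ
      0≤θ = nonneg w≥0 w∈is
      orthogonal : ∀ j → Q j → ∫ ((θ , i) ∷ scale (- ρ) w) (λ k → row k j) ≡ 0ℚ
      orthogonal j Qj = begin
        θ * row i j + ∫ (scale (- ρ) w) (λ k → row k j)
          ≡⟨ cong₂ _+_ (*-comm θ (row i j)) (trans (∫-scale (- ρ) w (λ k → row k j)) (sym (∫-* w (- ρ) (λ k → row k j)))) ⟩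
        row i j * θ + ∫ w (λ k → (- ρ) * row k j)
          ≡⟨ +-comm (row i j * θ) _ ⟩
        ∫ w (λ k → (- ρ) * row k j) + row i j * θ
          ≡⟨ cong (∫ w (λ k → (- ρ) * row k j) +_)
               (trans (sym (∫-* w (row i j) (λ k → ∫ x (row k)))) (∫-cong w (λ k → *-comm (row i j) (∫ x (row k))))) ⟩
        ∫ w (λ k → (- ρ) * row k j) + ∫ w (λ k → ∫ x (row k) * row i j)
          ≡⟨ ∫-+ w (λ k → (- ρ) * row k j) (λ k → ∫ x (row k) * row i j) ⟨
        ∫ w (λ k → project i row x k j)
          ≡⟨ w⊥ j Qj ⟩
        0ℚ ∎
        where open ≡-Reasoning

    gordan : ∀ is row → Solution is row ⊎ Certificate is row
    gordan [] row = inj₁ ([] , [] , [])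
    gordan (i ∷ is) row with gordan is row
    ... | inj₂ (w , w≥0 , w∈is , 0<w , w⊥) = inj₂ (w , w≥0 , All.map there w∈is , 0<w , w⊥)
    ... | inj₁ (x , Qx , xs) with <-cmp 0ℚ (∫ x (row i))
    ... | tri< 0<x _ _ = inj₁ (x , Qx , 0<x ∷ xs)
    ... | tri> _ _ x<0 = [ inj₁ ∘ lift-solution row {x} Qx x<0 , inj₂ ∘ lift-certificate row {x} xs x<0 ]′
            (gordan is (project i row x))
    ... | tri≈ _ 0≡x _ with search (row i)
    -- Row i vanishes at x. If it has a nonzero admissible entry r, moving x by r in that coordinate
    -- gives row i the value r²; otherwise row i alone is a certificate.
    ... | inj₁ (j , Qj , rj≢0) = inj₁ (perturb row {x} {(row i j , j) ∷ []} Qx (Qj ∷ []) xs (sym 0≡x)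
            (subst (0ℚ <_) (sym (+-identityʳ (row i j * row i j))) (0<square (row i j) rj≢0)))
    ... | inj₂ row≡0 = inj₂ ((1ℚ , i) ∷ [] , nonNegative⁻¹ 1ℚ ∷ [] , here refl ∷ [] , positive⁻¹ 1ℚ ,
            λ j Qj → trans (+-identityʳ (1ℚ * row i j)) (trans (*-identityˡ (row i j)) (row≡0 j Qj)))

open LinearAlternative

-- Degree of functions on the cube, and characters.

module BooleanPolynomials where

  open import Data.Rational
  open import Data.Rational.Properties

  Cube : ℕ → Set
  Cube n = Fin n → Bool

  Ext : ∀ {n} {A : Set} → (Cube n → A) → Set
  Ext h = ∀ {x y} → x ≗ y → h x ≡ h y

  monoEval-cong : ∀ {n} (S : Subset n) → Ext (monoEval S)
  monoEval-cong [] x≗y = refl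
  monoEval-cong (b ∷ S) x≗y =
    cong₂ (λ u v → (if b then ⟦ u ⟧ else 1ℚ) * v) (x≗y zero) (monoEval-cong S (x≗y ∘ suc))

  eval-cong : ∀ {n} (p : Poly n) → Ext (eval p)
  eval-cong p x≗y = ∫-cong p (λ S → monoEval-cong S x≗y)

  monoEval-∅ : ∀ n (x : Cube n) → monoEval ∅ x ≡ 1ℚ
  monoEval-∅ zero x = refl
  monoEval-∅ (suc n) x = trans (*-identityˡ _) (monoEval-∅ n (x ∘ suc))

  -- Bits are idempotent, so a variable common to S and T counts once; this is why degrees under
  -- products are only subadditive.
  monoEval-∪ : ∀ {n} (S T : Subset n) x → monoEval (S ∪ T) x ≡ monoEval S x * monoEval T x
  monoEval-∪ [] [] x = refl
  monoEval-∪ (b ∷ S) (c ∷ T) x = trans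
    (cong₂ _*_ (factor b c (x zero)) (monoEval-∪ S T (x ∘ suc)))
    (ring (if b then ⟦ x zero ⟧ else 1ℚ) (if c then ⟦ x zero ⟧ else 1ℚ) _ _)
    where
    factor : ∀ b c v → (if b ∨ c then ⟦ v ⟧ else 1ℚ) ≡ (if b then ⟦ v ⟧ else 1ℚ) * (if c then ⟦ v ⟧ else 1ℚ)
    factor false c v = sym (*-identityˡ _)
    factor true false v = sym (*-identityʳ _)
    factor true true true = refl
    factor true true false = refl
    ring : ∀ a b s t → (a * b) * (s * t) ≡ (a * s) * (b * t)
    ring = solve-∀ ℚ-ring

  size-∪ : ∀ {n} (S T : Subset n) → size (S ∪ T) ℕ.≤ size S ℕ.+ size T
  size-∪ [] [] = z≤n
  size-∪ (true ∷ S) (true ∷ T) =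
    s≤s (ℕ.≤-trans (size-∪ S T) (ℕ.+-monoʳ-≤ (size S) (ℕ.n≤1+n (size T))))
  size-∪ (true ∷ S) (false ∷ T) = s≤s (size-∪ S T)
  size-∪ (false ∷ S) (true ∷ T) =
    ℕ.≤-trans (s≤s (size-∪ S T)) (ℕ.≤-reflexive (sym (ℕ.+-suc (size S) (size T))))
  size-∪ (false ∷ S) (false ∷ T) = size-∪ S T

  -- The bound is attached to the function and not to a list of monomials, so that it passes along
  -- pointwise identities without normal forms.
  HasDeg : ∀ {n} → ℕ → (Cube n → ℚ) → Set
  HasDeg {n} k h = Σ (Poly n) λ p → DegLe p k × (∀ x → eval p x ≡ h x)

  module _ {n : ℕ} where

    hasDeg-cong : ∀ {k} {f g : Cube n → ℚ} → (∀ x → f x ≡ g x) → HasDeg k f → HasDeg k g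
    hasDeg-cong f≡g (p , deg , e) = p , deg , λ x → trans (e x) (f≡g x)

    hasDeg-mono : ∀ {k l} {f : Cube n → ℚ} → k ℕ.≤ l → HasDeg k f → HasDeg l f
    hasDeg-mono k≤l (p , deg , e) = p , All.map (λ s → ℕ.≤-trans s k≤l) deg , e

    hasDeg-const : ∀ c {k} → HasDeg {n} k (λ _ → c)
    hasDeg-const c =
      (c , ∅) ∷ [] , subst (ℕ._≤ _) (sym (∣∅∣≡0 n)) z≤n ∷ [] ,
      λ x → trans (+-identityʳ _) (trans (cong (c *_) (monoEval-∅ n x)) (*-identityʳ c))

    hasDeg-+ : ∀ {k} {f g : Cube n → ℚ} → HasDeg k f → HasDeg k g → HasDeg k (λ x → f x + g x)
    hasDeg-+ (p , deg-p , ep) (q , deg-q , eq) =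
      p ++ q , All-++⁺ deg-p deg-q , λ x → trans (∫-++ p q _) (cong₂ _+_ (ep x) (eq x))

    hasDeg-scale : ∀ c {k} {f : Cube n → ℚ} → HasDeg k f → HasDeg k (λ x → c * f x)
    hasDeg-scale c {k} (p , deg , e) =
      scale c p , scale-All {P = λ S → size S ℕ.≤ k} c deg , λ x → trans (∫-scale c p _) (cong (c *_) (e x))

    hasDeg-monomial-* : ∀ S {k} {f : Cube n → ℚ} → HasDeg k f →
                        HasDeg (size S ℕ.+ k) (λ x → monoEval S x * f x)
    hasDeg-monomial-* S {k} {f} (p , deg , e) =
      map times p , degree deg , λ x → trans (value p x) (cong (monoEval S x *_) (e x))
      where
      times : ℚ × Subset n → ℚ × Subset n
      times (c , T) = c , S ∪ T
      degree : ∀ {p} → DegLe p k → DegLe (map times p) (size S ℕ.+ k)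
      degree [] = []
      degree {(c , T) ∷ p} (d ∷ ds) = ℕ.≤-trans (size-∪ S T) (ℕ.+-monoʳ-≤ (size S) d) ∷ degree ds
      ring : ∀ c s t u → c * (s * t) + s * u ≡ s * (c * t + u)
      ring = solve-∀ ℚ-ring
      value : ∀ p x → eval (map times p) x ≡ monoEval S x * eval p x
      value [] x = sym (*-zeroʳ (monoEval S x))
      value ((c , T) ∷ p) x = trans
        (cong₂ (λ u v → c * u + v) (monoEval-∪ S T x) (value p x))
        (ring c (monoEval S x) (monoEval T x) (eval p x))

    hasDeg-* : ∀ {k l} {f g : Cube n → ℚ} → HasDeg k f → HasDeg l g → HasDeg (k ℕ.+ l) (λ x → f x * g x)
    hasDeg-* {k} {l} {f} {g} (p , deg , e) G =
      hasDeg-cong (λ x → cong (_* g x) (e x)) (product p deg)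
      where
      ring : ∀ c s u v → c * (s * v) + u * v ≡ (c * s + u) * v
      ring = solve-∀ ℚ-ring
      product : ∀ p → DegLe p k → HasDeg (k ℕ.+ l) (λ x → eval p x * g x)
      product [] [] = hasDeg-cong (λ x → sym (*-zeroˡ (g x))) (hasDeg-const 0ℚ)
      product ((c , S) ∷ p) (d ∷ ds) =
        hasDeg-cong (λ x → ring c (monoEval S x) (eval p x) (g x))
          (hasDeg-+ (hasDeg-scale c (hasDeg-mono (ℕ.+-monoˡ-≤ l d) (hasDeg-monomial-* S G))) (product p ds))

  hasDeg-tail : ∀ {n k} {f : Cube n → ℚ} → HasDeg k f → HasDeg {suc n} k (λ x → f (x ∘ suc))
  hasDeg-tail {n} {k} (p , deg , e) = map shift p , degree deg , λ x → trans (value p x) (e (x ∘ suc))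
    where
    shift : ℚ × Subset n → ℚ × Subset (suc n)
    shift (c , S) = c , false ∷ S
    degree : ∀ {p} → DegLe p k → DegLe (map shift p) k
    degree [] = []
    degree (d ∷ ds) = d ∷ degree ds
    value : ∀ p x → eval (map shift p) x ≡ eval p (x ∘ suc)
    value [] x = refl
    value ((c , S) ∷ p) x = cong₂ (λ u v → c * u + v) (*-identityˡ _) (value p x)

  hasDeg-head : ∀ {n} (u : Bool → ℚ) → HasDeg {suc n} 1 (λ x → u (x zero))
  hasDeg-head {n} u = hasDeg-cong (λ x → interpolate (x zero))
    (hasDeg-+ (hasDeg-const (u false)) (hasDeg-scale (u true - u false) variable₀))
    where
    variable₀ : HasDeg {suc n} 1 (λ x → ⟦ x zero ⟧)
    variable₀ = (1ℚ , true ∷ ∅) ∷ [] , ℕ.≤-reflexive (cong suc (∣∅∣≡0 n)) ∷ [] ,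
      λ x → trans (+-identityʳ _) (trans (*-identityˡ _)
        (trans (cong (⟦ x zero ⟧ *_) (monoEval-∅ n (x ∘ suc))) (*-identityʳ ⟦ x zero ⟧)))
    ring₀ : ∀ a b → b + (a - b) * 0ℚ ≡ b
    ring₀ = solve-∀ ℚ-ring
    ring₁ : ∀ a b → b + (a - b) * 1ℚ ≡ a
    ring₁ = solve-∀ ℚ-ring
    interpolate : ∀ b → u false + (u true - u false) * ⟦ b ⟧ ≡ u b
    interpolate true = ring₁ (u true) (u false)
    interpolate false = ring₀ (u true) (u false)

  par : ∀ {n} → Cube n → Bool
  par {zero} x = false
  par {suc n} x = x zero xor par (x ∘ suc)

  par-cong : ∀ {n} → Ext (par {n})
  par-cong {zero} x≗y = refl
  par-cong {suc n} x≗y = cong₂ _xor_ (x≗y zero) (par-cong (x≗y ∘ suc))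

  pm-not : ∀ b → pm (not b) ≡ - pm b
  pm-not true = refl
  pm-not false = refl

  pm-xor : ∀ a b → pm (a xor b) ≡ pm a * pm b
  pm-xor true true = refl
  pm-xor true false = refl
  pm-xor false b = sym (*-identityˡ (pm b))

  pm-square : ∀ b → pm b * pm b ≡ 1ℚ
  pm-square true = refl
  pm-square false = refl

  pm-injective : ∀ {a b} → pm a ≡ pm b → a ≡ b
  pm-injective {true} {true} e = refl
  pm-injective {false} {false} e = refl

  -1≤pm : ∀ b → - 1ℚ ≤ pm b
  -1≤pm true = ≤-refl
  -1≤pm false = ≤-trans (nonPositive⁻¹ (- 1ℚ)) (nonNegative⁻¹ 1ℚ)

  pm≤1 : ∀ b → pm b ≤ 1ℚ
  pm≤1 true = ≤-trans (nonPositive⁻¹ (- 1ℚ)) (nonNegative⁻¹ 1ℚ)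
  pm≤1 false = ≤-refl

  hasDeg-character : ∀ n → HasDeg n (λ (x : Cube n) → pm (par x))
  hasDeg-character zero = hasDeg-const 1ℚ
  hasDeg-character (suc n) = hasDeg-cong (λ x → sym (pm-xor (x zero) (par (x ∘ suc))))
    (hasDeg-* (hasDeg-head pm) (hasDeg-tail (hasDeg-character n)))

  -- Degree strictly below k. At k = 0 there is no predecessor to give to `HasDeg`, and only the
  -- zero function qualifies.
  DegLt : ∀ {n} → ℕ → (Cube n → ℚ) → Set
  DegLt zero h = ∀ x → h x ≡ 0ℚ
  DegLt (suc k) h = HasDeg k h

  cons : ∀ {n} → Bool → Cube n → Cube (suc n)
  cons b x zero = b
  cons b x (suc i) = x i

  cons-η : ∀ {n} (x : Cube (suc n)) → x ≗ cons (x zero) (x ∘ suc)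
  cons-η x zero = refl
  cons-η x (suc i) = refl

  cons-cong : ∀ {n} b {x y : Cube n} → x ≗ y → cons b x ≗ cons b y
  cons-cong b x≗y zero = refl
  cons-cong b x≗y (suc i) = x≗y i

  degLt-head-* : ∀ {n} k (u : Bool → ℚ) {q : Cube n → ℚ} → DegLt k q →
                 HasDeg {suc n} k (λ x → u (x zero) * q (x ∘ suc))
  degLt-head-* zero u q≡0 =
    hasDeg-cong (λ x → sym (trans (cong (u (x zero) *_) (q≡0 (x ∘ suc))) (*-zeroʳ (u (x zero))))) (hasDeg-const 0ℚ)
  degLt-head-* (suc k) u deg = hasDeg-* (hasDeg-head u) (hasDeg-tail deg)

  -- `coefficient` is the top Fourier coefficient of h. As the mean of h times the character it lies
  -- in [-1, 1] for h bounded by 1, and the last two fields are the equality cases. All are bundled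
  -- so that one induction on the dimension proves them together.
  record Decomposition {n : ℕ} (h : Cube n → ℚ) : Set where
    field
      coefficient : ℚ
      low : Cube n → ℚ
      degLt-low : DegLt n low
      decomposition : ∀ x → h x ≡ low x + coefficient * pm (par x)
      -1≤coefficient : - 1ℚ ≤ coefficient
      coefficient≤1 : coefficient ≤ 1ℚ
      coefficient≡1 : coefficient ≡ 1ℚ → ∀ x → h x ≡ pm (par x)
      coefficient≡-1 : coefficient ≡ - 1ℚ → ∀ x → h x ≡ - pm (par x)

  half-diff≤1 : ∀ {a b} → a ≤ 1ℚ → - 1ℚ ≤ b → ½ * (a - b) ≤ 1ℚ
  half-diff≤1 {a} {b} a≤1 -1≤b =
    ≤-by-gap (½ * ((1ℚ - a) + (b - - 1ℚ)))
      (0≤* (nonNegative⁻¹ ½) (0≤+ (x≤y⇒0≤y-x a≤1) (x≤y⇒0≤y-x -1≤b))) (ring a b)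
    where
    ring : ∀ a b → 1ℚ ≡ ½ * (a - b) + ½ * ((1ℚ - a) + (b - - 1ℚ))
    ring = solve-∀ ℚ-ring

  half-diff≡1 : ∀ {a b} → a ≤ 1ℚ → - 1ℚ ≤ b → ½ * (a - b) ≡ 1ℚ → a ≡ 1ℚ × b ≡ - 1ℚ
  half-diff≡1 {a} {b} a≤1 -1≤b e = ≤-antisym a≤1 1≤a , ≤-antisym b≤-1 -1≤b
    where
    ring-a : ∀ a b → a ≡ ½ * (a - b) + ½ * (a - b) + - 1ℚ + (b - - 1ℚ)
    ring-a = solve-∀ ℚ-ring
    1≤a : 1ℚ ≤ a
    1≤a = ≤-by-gap (b - - 1ℚ) (x≤y⇒0≤y-x -1≤b)
      (trans (ring-a a b) (cong (λ u → u + u + - 1ℚ + (b - - 1ℚ)) e))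
    b≤-1 : b ≤ - 1ℚ
    b≤-1 = ≤-by-gap (1ℚ - a) (x≤y⇒0≤y-x a≤1) (trans (cong (λ u → 1ℚ - (u + u)) (sym e)) (ring-c a b))
      where
      ring-c : ∀ a b → 1ℚ - (½ * (a - b) + ½ * (a - b)) ≡ b + (1ℚ - a)
      ring-c = solve-∀ ℚ-ring

open BooleanPolynomials

-- Functions of full sign degree are parities up to negation.

module FullSignDegree where

  open import Data.Rational
  open import Data.Rational.Properties

  -- Split on the first bit. The full character is ±χ, with χ the character of the remaining bits,
  -- so coefficients c₀ and c₁ of the halves combine to (c₀ - c₁)/2. The other combination (c₀ +
  -- c₁)/2 multiplies χ alone, which has degree n and belongs to the low part. A value ±1 of (c₀ -
  -- c₁)/2 forces both halves to be extremal.
  decompose : ∀ n (h : Cube n → ℚ) → Ext h → (∀ x → - 1ℚ ≤ h x) → (∀ x → h x ≤ 1ℚ) → Decomposition h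
  decompose zero h ext -1≤h h≤1 = record
    { coefficient = h (λ ())
    ; low = λ _ → 0ℚ
    ; degLt-low = λ _ → refl
    ; decomposition = λ x → trans (constant x) (ring (h (λ ())))
    ; -1≤coefficient = -1≤h (λ ())
    ; coefficient≤1 = h≤1 (λ ())
    ; coefficient≡1 = λ e x → trans (constant x) e
    ; coefficient≡-1 = λ e x → trans (constant x) e
    }
    where
    constant : ∀ x → h x ≡ h (λ ())
    constant x = ext (λ ())
    ring : ∀ c → c ≡ 0ℚ + c * 1ℚ
    ring = solve-∀ ℚ-ring
  decompose (suc n) h ext -1≤h h≤1 = record
    { coefficient = ½ * (c₀ - c₁)
    ; low = λ x → (⟦ not (x zero) ⟧ * D₀.low (x ∘ suc) + ⟦ x zero ⟧ * D₁.low (x ∘ suc))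
                  + (½ * (c₀ + c₁)) * pm (par (x ∘ suc))
    ; degLt-low = hasDeg-+
        (hasDeg-+ (degLt-head-* n (⟦_⟧ ∘ not) D₀.degLt-low) (degLt-head-* n ⟦_⟧ D₁.degLt-low))
        (hasDeg-scale (½ * (c₀ + c₁)) (hasDeg-tail (hasDeg-character n)))
    ; decomposition = λ x → by-head x (x zero) refl
    ; -1≤coefficient = subst (- 1ℚ ≤_) (ring-neg c₁ c₀)
        (neg-antimono-≤ (half-diff≤1 D₁.coefficient≤1 D₀.-1≤coefficient))
    ; coefficient≤1 = half-diff≤1 D₀.coefficient≤1 D₁.-1≤coefficient
    ; coefficient≡1 = λ e x → trans (ext (cons-η x)) (by-head-1 e (x zero) (x ∘ suc))
    ; coefficient≡-1 = λ e x → trans (ext (cons-η x)) (by-head-neg-1 e (x zero) (x ∘ suc))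
    }
    where
    restrict : ∀ b → Decomposition (h ∘ cons b)
    restrict b = decompose n (h ∘ cons b) (ext ∘ cons-cong b) (-1≤h ∘ cons b) (h≤1 ∘ cons b)
    module D₀ = Decomposition (restrict false)
    module D₁ = Decomposition (restrict true)
    c₀ c₁ : ℚ
    c₀ = D₀.coefficient
    c₁ = D₁.coefficient
    ring-neg : ∀ a b → - (½ * (a - b)) ≡ ½ * (b - a)
    ring-neg = solve-∀ ℚ-ring
    ring₀ : ∀ p q a b χ → p + a * χ ≡ ((1ℚ * p + 0ℚ * q) + (½ * (a + b)) * χ) + (½ * (a - b)) * χ
    ring₀ = solve-∀ ℚ-ring
    ring₁ : ∀ p q a b χ → q + b * χ ≡ ((0ℚ * p + 1ℚ * q) + (½ * (a + b)) * χ) + (½ * (a - b)) * (- χ)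
    ring₁ = solve-∀ ℚ-ring
    low : Bool → Cube n → ℚ
    low b y = (⟦ not b ⟧ * D₀.low y + ⟦ b ⟧ * D₁.low y) + (½ * (c₀ + c₁)) * pm (par y)
    by-head : ∀ x b → x zero ≡ b → h x ≡ low (x zero) (x ∘ suc) + (½ * (c₀ - c₁)) * pm (x zero xor par (x ∘ suc))
    by-head x false e rewrite e = trans (ext x≗cons) (trans (D₀.decomposition (x ∘ suc))
      (ring₀ (D₀.low (x ∘ suc)) (D₁.low (x ∘ suc)) c₀ c₁ (pm (par (x ∘ suc)))))
      where
      x≗cons : x ≗ cons false (x ∘ suc)
      x≗cons i = trans (cons-η x i) (cong (λ b → cons b (x ∘ suc) i) e)
    by-head x true e rewrite e = trans (ext x≗cons) (trans (D₁.decomposition (x ∘ suc))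
      (trans (ring₁ (D₀.low (x ∘ suc)) (D₁.low (x ∘ suc)) c₀ c₁ (pm (par (x ∘ suc))))
        (cong (λ u → low true (x ∘ suc) + (½ * (c₀ - c₁)) * u) (sym (pm-not (par (x ∘ suc)))))))
      where
      x≗cons : x ≗ cons true (x ∘ suc)
      x≗cons i = trans (cons-η x i) (cong (λ b → cons b (x ∘ suc) i) e)
    by-head-1 : ½ * (c₀ - c₁) ≡ 1ℚ → ∀ b y → h (cons b y) ≡ pm (b xor par y)
    by-head-1 e false y = D₀.coefficient≡1 (proj₁ (half-diff≡1 D₀.coefficient≤1 D₁.-1≤coefficient e)) y
    by-head-1 e true y = trans
      (D₁.coefficient≡-1 (proj₂ (half-diff≡1 D₀.coefficient≤1 D₁.-1≤coefficient e)) y) (sym (pm-not (par y)))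
    by-head-neg-1 : ½ * (c₀ - c₁) ≡ - 1ℚ → ∀ b y → h (cons b y) ≡ - pm (b xor par y)
    by-head-neg-1 e b y = by-bit b
      where
      swapped : c₁ ≡ 1ℚ × c₀ ≡ - 1ℚ
      swapped = half-diff≡1 D₁.coefficient≤1 D₀.-1≤coefficient
        (trans (sym (ring-neg c₀ c₁)) (cong -_ e))
      by-bit : ∀ b → h (cons b y) ≡ - pm (b xor par y)
      by-bit false = D₀.coefficient≡-1 (proj₂ swapped) y
      by-bit true = trans (D₁.coefficient≡1 (proj₁ swapped) y)
        (trans (sym (neg-involutive (pm (par y)))) (cong -_ (sym (pm-not (par y)))))
        where
        neg-involutive : ∀ a → - (- a) ≡ a
        neg-involutive = solve-∀ ℚ-ring

  same-sign : ∀ {u} a b → 0ℚ < pm a * u → 0ℚ < pm b * u → a ≡ b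
  same-sign true true _ _ = refl
  same-sign false false _ _ = refl
  same-sign {u} true false 0<-u 0<u = ⊥-elim (<-irrefl (sym (ring u)) (+-mono-< 0<-u 0<u))
    where
    ring : ∀ u → - 1ℚ * u + 1ℚ * u ≡ 0ℚ
    ring = solve-∀ ℚ-ring
  same-sign {u} false true 0<u 0<-u = sym (same-sign {u} true false 0<-u 0<u)

  -- A polynomial takes equal values at pointwise equal points, and its sign determines F.
  signRepresents⇒ext : ∀ {n} (F : BoolFn n) (p : Poly n) → SignRepresents p F → Ext F
  signRepresents⇒ext F p rep {x} {y} x≗y =
    same-sign (F x) (F y) (rep x) (subst (λ u → 0ℚ < pm (F y) * u) (sym (eval-cong p x≗y)) (rep y))

  -- If the coefficient c of the character χ in ±F is not ±1 then |c| < 1, and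
  -- F · (F − c χ) = 1 − c F χ > 0, so that F − c χ sign-represents F in degree below n.
  fullSignDeg⇒parity : ∀ {n} (F : BoolFn n) → FullSignDeg F → Σ Bool λ β → ∀ x → F x ≡ β xor par x
  fullSignDeg⇒parity {n} F ((p , _ , rep) , minimal) = by-coefficient (coefficient ≟ 1ℚ) (coefficient ≟ - 1ℚ)
    where
    F-ext : Ext F
    F-ext = signRepresents⇒ext F p rep
    open Decomposition (decompose n (pm ∘ F) (λ x≗y → cong pm (F-ext x≗y)) (λ x → -1≤pm (F x)) (λ x → pm≤1 (F x)))
    c : ℚ
    c = coefficient
    too-low : ∀ n {q : Cube n → ℚ} (F : BoolFn n) → DegLt n q → (∀ x → 0ℚ < pm (F x) * q x) →
              (∀ (p : Poly n) D → DegLe p D → SignRepresents p F → n ℕ.≤ D) → ⊥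
    too-low zero F q≡0 pos min =
      <-irrefl (sym (trans (cong (pm (F (λ ())) *_) (q≡0 (λ ()))) (*-zeroʳ (pm (F (λ ())))))) (pos (λ ()))
    too-low (suc k) F (q , deg , e) pos min =
      ℕ.<-irrefl refl (min q k deg (λ x → subst (λ u → 0ℚ < pm (F x) * u) (sym (e x)) (pos x)))
    sign : c ≢ 1ℚ → c ≢ - 1ℚ → ∀ x → 0ℚ < pm (F x) * low x
    sign c≢1 c≢-1 x = subst (0ℚ <_) (sym value) (margin (F x xor par x))
      where
      ring : ∀ s q c χ → s * q ≡ s * (q + c * χ) - c * (s * χ)
      ring = solve-∀ ℚ-ring
      value : pm (F x) * low x ≡ 1ℚ - c * pm (F x xor par x)
      value = trans (ring (pm (F x)) (low x) c (pm (par x)))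
        (cong₂ _-_ (trans (cong (pm (F x) *_) (sym (decomposition x))) (pm-square (F x)))
                   (cong (c *_) (sym (pm-xor (F x) (par x)))))
      strict : ∀ {a b} → a ≤ b → a ≢ b → a < b
      strict a≤b a≢b = ≰⇒> (λ b≤a → a≢b (≤-antisym a≤b b≤a))
      ring-true : ∀ c → c - - 1ℚ ≡ 1ℚ - c * - 1ℚ
      ring-true = solve-∀ ℚ-ring
      ring-false : ∀ c → 1ℚ - c ≡ 1ℚ - c * 1ℚ
      ring-false = solve-∀ ℚ-ring
      margin : ∀ b → 0ℚ < 1ℚ - c * pm b
      margin true = subst (0ℚ <_) (ring-true c) (x<y⇒0<y-x (strict -1≤coefficient (c≢-1 ∘ sym)))
      margin false = subst (0ℚ <_) (ring-false c) (x<y⇒0<y-x (strict coefficient≤1 c≢1))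
    by-coefficient : Dec (c ≡ 1ℚ) → Dec (c ≡ - 1ℚ) → Σ Bool λ β → ∀ x → F x ≡ β xor par x
    by-coefficient (yes c≡1) _ = false , λ x → pm-injective (coefficient≡1 c≡1 x)
    by-coefficient (no _) (yes c≡-1) =
      true , λ x → pm-injective (trans (coefficient≡-1 c≡-1 x) (sym (pm-not (par x))))
    by-coefficient (no c≢1) (no c≢-1) = ⊥-elim (too-low n F degLt-low (sign c≢1 c≢-1) minimal)

  -- Parities under composition.

  par-xor : ∀ {n} (x y : Cube n) → par (λ i → x i xor y i) ≡ par x xor par y
  par-xor {zero} x y = refl
  par-xor {suc n} x y = trans (cong ((x zero xor y zero) xor_) (par-xor (x ∘ suc) (y ∘ suc)))
    (interchange (x zero) (y zero) (par (x ∘ suc)) (par (y ∘ suc)))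

  par-++ : ∀ m {n} (x : Cube (m ℕ.+ n)) → par x ≡ par (λ i → x (i ↑ˡ n)) xor par (λ j → x (m ↑ʳ j))
  par-++ zero x = refl
  par-++ (suc m) x = trans (cong (x zero xor_) (par-++ m (x ∘ suc))) (sym (xor-assoc (x zero) _ _))

  par-combine : ∀ m {n} (x : Cube (m ℕ.* n)) → par {m} (λ i → par {n} (λ j → x (combine i j))) ≡ par x
  par-combine zero x = refl
  par-combine (suc m) {n} x = trans
    (cong (par (λ j → x (j ↑ˡ (m ℕ.* n))) xor_) (par-combine m (λ k → x (n ↑ʳ k))))
    (sym (par-++ n x))

  -- A parity of block parities is the parity of all bits. The negation γ of the inner copies enters
  -- once per block, hence contributes the parity of the constant vector γ.
  parity-^^ : ∀ {n} (F : BoolFn n) {β} → (∀ x → F x ≡ β xor par x) →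
              ∀ d → Σ Bool λ γ → ∀ x → (F ^^ d) x ≡ γ xor par x
  parity-^^ F F≡ zero = false , λ x → xor-identity (x zero)
    where
    xor-identity : ∀ a → a ≡ a xor false
    xor-identity true = refl
    xor-identity false = refl
  parity-^^ {n} F {β} F≡ (suc d) with parity-^^ F {β} F≡ d
  ... | γ , G≡ = β xor par {n} (λ _ → γ) , λ x → begin
    F (λ i → (F ^^ d) (block x i))
      ≡⟨ F≡ (λ i → (F ^^ d) (block x i)) ⟩
    β xor par (λ i → (F ^^ d) (block x i))
      ≡⟨ cong (β xor_) (par-cong (λ i → G≡ (block x i))) ⟩
    β xor par (λ i → γ xor par (block x i))
      ≡⟨ cong (β xor_) (par-xor (λ _ → γ) (λ i → par (block x i))) ⟩
    β xor (par {n} (λ _ → γ) xor par (λ i → par (block x i)))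
      ≡⟨ cong (λ u → β xor (par {n} (λ _ → γ) xor u)) (par-combine n x) ⟩
    β xor (par {n} (λ _ → γ) xor par x)
      ≡⟨ xor-assoc β (par {n} (λ _ → γ)) (par x) ⟨
    (β xor par {n} (λ _ → γ)) xor par x ∎
    where
    open ≡-Reasoning
    block : Cube (n ℕ.* n ℕ.^ d) → Fin n → Cube (n ℕ.^ d)
    block x i j = x (combine i j)

open FullSignDegree

-- Averaging over parity fibres, and the inner parity.

module FibreAverages where

  open import Data.Rational
  open import Data.Rational.Properties

  append : ∀ m {n} → Cube m → Cube n → Cube (m ℕ.+ n)
  append zero x y = y
  append (suc m) x y zero = x zero
  append (suc m) x y (suc i) = append m (x ∘ suc) y i

  append-↑ˡ : ∀ m {n} (x : Cube m) (y : Cube n) i → append m x y (i ↑ˡ n) ≡ x i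
  append-↑ˡ (suc m) x y zero = refl
  append-↑ˡ (suc m) x y (suc i) = append-↑ˡ m (x ∘ suc) y i

  append-↑ʳ : ∀ m {n} (x : Cube m) (y : Cube n) i → append m x y (m ↑ʳ i) ≡ y i
  append-↑ʳ zero x y i = refl
  append-↑ʳ (suc m) x y i = append-↑ʳ m (x ∘ suc) y i

  monoEval-append : ∀ m {n} (S : Subset m) (T : Subset n) x y →
                    monoEval (S ++ᵛ T) (append m x y) ≡ monoEval S x * monoEval T y
  monoEval-append zero [] T x y = sym (*-identityˡ (monoEval T y))
  monoEval-append (suc m) (b ∷ S) T x y = trans
    (cong ((if b then ⟦ x zero ⟧ else 1ℚ) *_) (monoEval-append m S T (x ∘ suc) y))
    (sym (*-assoc (if b then ⟦ x zero ⟧ else 1ℚ) (monoEval S (x ∘ suc)) (monoEval T y)))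

  size-++ : ∀ {m n} (S : Subset m) (T : Subset n) → size (S ++ᵛ T) ≡ size S ℕ.+ size T
  size-++ [] T = refl
  size-++ (true ∷ S) T = cong suc (size-++ S T)
  size-++ (false ∷ S) T = size-++ S T

  -- The mean over {y : par y = z}, on n + 1 bits because the other fibre is empty on 0 bits.
  average : ∀ n → Bool → (Cube (suc n) → ℚ) → ℚ
  average zero z h = h (λ _ → z)
  average (suc n) z h = ½ * (average n z (h ∘ cons false) + average n (not z) (h ∘ cons true))

  average-mono : ∀ n z {f g} → (∀ y → par y ≡ z → f y ≤ g y) → average n z f ≤ average n z g
  average-mono zero z f≤g = f≤g (λ _ → z) (xor-identity z)
    where
    xor-identity : ∀ a → a xor false ≡ a
    xor-identity true = refl
    xor-identity false = refl
  average-mono (suc n) z f≤g = *-monoˡ-≤-nonNeg ½ (+-mono-≤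
    (average-mono n z (λ y → f≤g (cons false y)))
    (average-mono n (not z) (λ y e → f≤g (cons true y) (trans (cong not e) (not-involutive z)))))

  average-cong : ∀ n z {f g} → (∀ y → f y ≡ g y) → average n z f ≡ average n z g
  average-cong n z e = ≤-antisym
    (average-mono n z (λ y _ → ≤-reflexive (e y))) (average-mono n z (λ y _ → ≤-reflexive (sym (e y))))

  average-const : ∀ n z c → average n z (λ _ → c) ≡ c
  average-const zero z c = refl
  average-const (suc n) z c = trans
    (cong₂ (λ u v → ½ * (u + v)) (average-const n z c) (average-const n (not z) c)) (ring c)
    where
    ring : ∀ c → ½ * (c + c) ≡ c
    ring = solve-∀ ℚ-ring

  average-scale : ∀ n z c f → average n z (λ y → c * f y) ≡ c * average n z f
  average-scale zero z c f = refl
  average-scale (suc n) z c f = trans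
    (cong₂ (λ u v → ½ * (u + v)) (average-scale n z c (f ∘ cons false)) (average-scale n (not z) c (f ∘ cons true)))
    (ring c (average n z (f ∘ cons false)) (average n (not z) (f ∘ cons true)))
    where
    ring : ∀ c u v → ½ * (c * u + c * v) ≡ c * (½ * (u + v))
    ring = solve-∀ ℚ-ring

  average-∫ : ∀ n z {A : Set} (p : FormalSum A) (f : A → Cube (suc n) → ℚ) →
              average n z (λ y → ∫ p (λ a → f a y)) ≡ ∫ p (λ a → average n z (f a))
  average-∫ zero z p f = refl
  average-∫ (suc n) z p f = trans
    (cong₂ (λ u v → ½ * (u + v))
      (average-∫ n z p (λ a → f a ∘ cons false)) (average-∫ n (not z) p (λ a → f a ∘ cons true)))
    (trans (cong (½ *_) (sym (∫-+ p _ _))) (sym (∫-* p ½ _)))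

  -- Flipping a coordinate outside S exchanges the two fibres and leaves the monomial unchanged.
  average-low : ∀ n (S : Subset (suc n)) → size S ℕ.< suc n →
                average n true (monoEval S) ≡ average n false (monoEval S)
  average-low zero (false ∷ []) _ = refl
  average-low zero (true ∷ []) (s≤s ())
  average-low (suc n) (b ∷ S) lt = trans (expand true) (trans (balanced b lt) (sym (expand false)))
    where
    factor : Bool → ℚ
    factor v = if b then ⟦ v ⟧ else 1ℚ
    expand : ∀ z → average (suc n) z (monoEval (b ∷ S)) ≡
                   ½ * (factor false * average n z (monoEval S) + factor true * average n (not z) (monoEval S))
    expand z = cong₂ (λ u v → ½ * (u + v))
      (average-scale n z (factor false) (monoEval S)) (average-scale n (not z) (factor true) (monoEval S))
    balanced : ∀ b → size (b ∷ S) ℕ.< suc (suc n) →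
      ½ * ((if b then 0ℚ else 1ℚ) * average n true (monoEval S) + (if b then 1ℚ else 1ℚ) * average n false (monoEval S)) ≡
      ½ * ((if b then 0ℚ else 1ℚ) * average n false (monoEval S) + (if b then 1ℚ else 1ℚ) * average n true (monoEval S))
    balanced true (s≤s lt) rewrite average-low n S lt = refl
    balanced false _ = cong (½ *_) (+-comm (1ℚ * average n true (monoEval S)) (1ℚ * average n false (monoEval S)))

  -- The fibre over z of all block parities is a product of fibres, so the iterated mean is the mean
  -- over that fibre.
  averageBlocks : ∀ k n → Cube n → (Cube (n ℕ.* suc k) → ℚ) → ℚ
  averageBlocks k zero z h = h (λ ())
  averageBlocks k (suc n) z h =
    average k (z zero) (λ x → averageBlocks k n (z ∘ suc) (λ y → h (append (suc k) x y)))

  module _ (k : ℕ) where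

    -- The comparison is demanded only on the fibre over z. There the composed function is constant,
    -- so error bounds for an approximant survive averaging.
    averageBlocks-mono : ∀ n z {f g} →
      (∀ y → (∀ i → par (λ j → y (combine {n} {suc k} i j)) ≡ z i) → f y ≤ g y) →
      averageBlocks k n z f ≤ averageBlocks k n z g
    averageBlocks-mono zero z f≤g = f≤g (λ ()) (λ ())
    averageBlocks-mono (suc n) z {f} {g} f≤g =
      average-mono k (z zero) (λ x ex → averageBlocks-mono n (z ∘ suc) (λ y ey → f≤g (append (suc k) x y) (blocks x y ex ey)))
      where
      blocks : ∀ x y → par x ≡ z zero → (∀ i → par (λ j → y (combine i j)) ≡ z (suc i)) →
               ∀ i → par (λ j → append (suc k) x y (combine {suc n} i j)) ≡ z i
      blocks x y ex ey zero = trans (par-cong (append-↑ˡ (suc k) x y)) ex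
      blocks x y ex ey (suc i) = trans (par-cong (λ j → append-↑ʳ (suc k) x y (combine i j))) (ey i)

    averageBlocks-cong : ∀ n z {f g} → (∀ y → f y ≡ g y) → averageBlocks k n z f ≡ averageBlocks k n z g
    averageBlocks-cong n z e = ≤-antisym
      (averageBlocks-mono n z (λ y _ → ≤-reflexive (e y))) (averageBlocks-mono n z (λ y _ → ≤-reflexive (sym (e y))))

    averageBlocks-const : ∀ n z c → averageBlocks k n z (λ _ → c) ≡ c
    averageBlocks-const zero z c = refl
    averageBlocks-const (suc n) z c = trans
      (average-cong k (z zero) (λ _ → averageBlocks-const n (z ∘ suc) c)) (average-const k (z zero) c)

    averageBlocks-scale : ∀ n z c f → averageBlocks k n z (λ y → c * f y) ≡ c * averageBlocks k n z f
    averageBlocks-scale zero z c f = refl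
    averageBlocks-scale (suc n) z c f = trans
      (average-cong k (z zero) (λ x → averageBlocks-scale n (z ∘ suc) c (λ y → f (append (suc k) x y))))
      (average-scale k (z zero) c _)

    averageBlocks-∫ : ∀ n z {A : Set} (p : FormalSum A) (f : A → Cube (n ℕ.* suc k) → ℚ) →
      averageBlocks k n z (λ y → ∫ p (λ a → f a y)) ≡ ∫ p (λ a → averageBlocks k n z (f a))
    averageBlocks-∫ zero z p f = refl
    averageBlocks-∫ (suc n) z p f = trans
      (average-cong k (z zero) (λ x → averageBlocks-∫ n (z ∘ suc) p (λ a y → f a (append (suc k) x y))))
      (average-∫ k (z zero) p _)

    -- A block contributes a variable to the averaged monomial only if it lies inside S.
    averageBlocks-monomial : ∀ γ n (S : Subset (n ℕ.* suc k)) → Σ ℕ λ d → d ℕ.* suc k ℕ.≤ size S ×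
      HasDeg {n} d (λ z → averageBlocks k n (λ i → γ xor z i) (monoEval S))
    averageBlocks-monomial γ zero S = 0 , z≤n , hasDeg-const (averageBlocks k zero (λ ()) (monoEval S))
    averageBlocks-monomial γ (suc n) S with splitAtᵛ (suc k) S
    ... | S₁ , S₂ , refl with averageBlocks-monomial γ n S₂
    ... | d , d≤ , deg = by-size (size S₁ ℕ.<? suc k)
      where
      block : Bool → ℚ
      block b = average k (γ xor b) (monoEval S₁)
      rest : Cube n → ℚ
      rest z = averageBlocks k n (λ i → γ xor z i) (monoEval S₂)
      product : ∀ (z : Cube (suc n)) → block (z zero) * rest (z ∘ suc) ≡
        averageBlocks k (suc n) (λ i → γ xor z i) (monoEval (S₁ ++ᵛ S₂))
      product z = sym (trans
        (average-cong k _ (λ x → trans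
          (averageBlocks-cong n _ (λ y → monoEval-append (suc k) S₁ S₂ x y))
          (trans (averageBlocks-scale n _ (monoEval S₁ x) (monoEval S₂)) (*-comm (monoEval S₁ x) (rest (z ∘ suc))))))
        (trans (average-scale k _ (rest (z ∘ suc)) (monoEval S₁)) (*-comm (rest (z ∘ suc)) (block (z zero)))))
      constant : size S₁ ℕ.< suc k → ∀ b → block false ≡ block b
      constant lt b = independent (γ xor false) (γ xor b)
        where
        independent : ∀ a b → average k a (monoEval S₁) ≡ average k b (monoEval S₁)
        independent true true = refl
        independent false false = refl
        independent true false = average-low k S₁ lt
        independent false true = sym (average-low k S₁ lt)
      by-size : Dec (size S₁ ℕ.< suc k) → Σ ℕ λ d → d ℕ.* suc k ℕ.≤ size (S₁ ++ᵛ S₂) ×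
        HasDeg {suc n} d (λ z → averageBlocks k (suc n) (λ i → γ xor z i) (monoEval (S₁ ++ᵛ S₂)))
      by-size (yes lt) = d ,
        subst (d ℕ.* suc k ℕ.≤_) (sym (size-++ S₁ S₂)) (ℕ.≤-trans d≤ (ℕ.m≤n+m (size S₂) (size S₁))) ,
        hasDeg-cong (λ z → trans (cong (_* rest (z ∘ suc)) (constant lt (z zero))) (product z))
          (hasDeg-scale (block false) (hasDeg-tail deg))
      by-size (no ≮) = suc d ,
        subst (suc d ℕ.* suc k ℕ.≤_) (sym (size-++ S₁ S₂)) (ℕ.+-mono-≤ (ℕ.≮⇒≥ ≮) d≤) ,
        hasDeg-cong product (hasDeg-* (hasDeg-head block) (hasDeg-tail deg))

    -- Each surviving variable uses up a whole block of `suc k` variables, which divides the degree.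
    -- The shift by γ makes the result an approximant of f itself when the inner function is a
    -- negated parity.
    averageBlocks-eval : ∀ γ {n D} (p : Poly (n ℕ.* suc k)) → DegLe p D →
      HasDeg {n} (D ℕ./ suc k) (λ z → averageBlocks k n (λ i → γ xor z i) (eval p))
    averageBlocks-eval γ {n} {D} p deg =
      hasDeg-cong (λ z → sym (averageBlocks-∫ n (λ i → γ xor z i) p monoEval)) (sum p deg)
      where
      sum : ∀ p → DegLe p D →
            HasDeg {n} (D ℕ./ suc k) (λ z → ∫ p (λ S → averageBlocks k n (λ i → γ xor z i) (monoEval S)))
      sum [] [] = hasDeg-const 0ℚ
      sum ((c , S) ∷ p) (s ∷ ss) = hasDeg-+ (hasDeg-scale c (monomial (averageBlocks-monomial γ n S))) (sum p ss)
        where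
        f : Cube n → ℚ
        f z = averageBlocks k n (λ i → γ xor z i) (monoEval S)
        monomial : (Σ ℕ λ d → d ℕ.* suc k ℕ.≤ size S × HasDeg d f) → HasDeg (D ℕ./ suc k) f
        monomial (d , d≤ , deg) = hasDeg-mono
          (subst (ℕ._≤ D ℕ./ suc k) (ℕ.m*n/n≡m d (suc k)) (ℕ./-monoˡ-≤ (suc k) (ℕ.≤-trans d≤ s))) deg

  ∣a-b∣≤e⇒a≤b+e : ∀ a b e → ∣ a - b ∣ ≤ e → a ≤ b + e
  ∣a-b∣≤e⇒a≤b+e a b e h = ≤-by-gap (e - (a - b)) (x≤y⇒0≤y-x (≤-trans (p≤∣p∣ (a - b)) h)) (ring a b e)
    where
    ring : ∀ a b e → b + e ≡ a + (e - (a - b))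
    ring = solve-∀ ℚ-ring

  ∣a-b∣≤e⇒b-e≤a : ∀ a b e → ∣ a - b ∣ ≤ e → b - e ≤ a
  ∣a-b∣≤e⇒b-e≤a a b e h =
    ≤-by-gap (e - - (a - b)) (x≤y⇒0≤y-x (≤-trans (-p≤∣p∣ (a - b)) h)) (ring a b e)
    where
    ring : ∀ a b e → a ≡ b - e + (e - - (a - b))
    ring = solve-∀ ℚ-ring

  ∣a-b∣≤e-intro : ∀ a b e → b - e ≤ a → a ≤ b + e → ∣ a - b ∣ ≤ e
  ∣a-b∣≤e-intro a b e lower upper = ∣p∣≤q
    (≤-by-gap (b + e - a) (x≤y⇒0≤y-x upper) (ring-upper a b e))
    (≤-by-gap (a - (b - e)) (x≤y⇒0≤y-x lower) (ring-lower a b e))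
    where
    ring-upper : ∀ a b e → e ≡ a - b + (b + e - a)
    ring-upper = solve-∀ ℚ-ring
    ring-lower : ∀ a b e → e ≡ - (a - b) + (a - (b - e))
    ring-lower = solve-∀ ℚ-ring

  approximates⇒ext : ∀ {n} (F : BoolFn n) {p : Poly n} → Approximates p F → Ext F
  approximates⇒ext F {p} approx {x} {y} x≗y = same {eval p x} (F x) (F y) (approx x)
    (subst (λ u → ∣ u - ⟦ F y ⟧ ∣ ≤ oneThird) (sym (eval-cong p x≗y)) (approx y))
    where
    apart : ∀ v → ∣ v - 1ℚ ∣ ≤ oneThird → ∣ v - 0ℚ ∣ ≤ oneThird → ∀ {A : Set} → A
    apart v h1 h0 =
      ⊥-elim (≤⇒≤ᵇ (≤-trans (∣a-b∣≤e⇒b-e≤a v 1ℚ oneThird h1) (∣a-b∣≤e⇒a≤b+e v 0ℚ oneThird h0)))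
    same : ∀ {v} a b → ∣ v - ⟦ a ⟧ ∣ ≤ oneThird → ∣ v - ⟦ b ⟧ ∣ ≤ oneThird → a ≡ b
    same true true _ _ = refl
    same false false _ _ = refl
    same {v} true false h1 h0 = apart v h1 h0
    same {v} false true h0 h1 = apart v h1 h0

  hasDeg⇒approxDeg≤ : ∀ {n k a} (F : BoolFn n) {h : Cube n → ℚ} → HasDeg k h →
    (∀ x → ∣ h x - ⟦ F x ⟧ ∣ ≤ oneThird) → IsApproxDeg F a → a ℕ.≤ k
  hasDeg⇒approxDeg≤ {k = k} F (p , deg , e) close (_ , minimal) =
    minimal p k deg (λ x → subst (λ u → ∣ u - ⟦ F x ⟧ ∣ ≤ oneThird) (sym (e x)) (close x))

  module _ {N : ℕ} (H : BoolFn N) (γ : Bool) (H≡ : ∀ x → H x ≡ γ xor par x) where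

    -- ½ - ½ (±χ) represents the function exactly. An upper bound is the direction required, since
    -- the product of the degrees is to be bounded from above.
    parity-approxDeg≤ : ∀ {a} → IsApproxDeg H a → a ℕ.≤ N
    parity-approxDeg≤ = hasDeg⇒approxDeg≤ H
      (hasDeg-+ (hasDeg-const ½) (hasDeg-scale (- ½ * pm γ) (hasDeg-character N)))
      (λ x → subst (λ u → ∣ u - ⟦ H x ⟧ ∣ ≤ oneThird) (exact x)
        (subst (λ u → ∣ u ∣ ≤ oneThird) (sym (+-inverseʳ ⟦ H x ⟧)) (nonNegative⁻¹ oneThird)))
      where
      bit : ∀ b → ⟦ b ⟧ ≡ ½ + - ½ * pm b
      bit true = refl
      bit false = refl
      exact : ∀ x → ⟦ H x ⟧ ≡ ½ + - ½ * pm γ * pm (par x)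
      exact x = trans (bit (H x)) (trans (cong (λ b → ½ + - ½ * pm b) (H≡ x))
        (trans (cong (λ u → ½ + - ½ * u) (pm-xor γ (par x))) (cong (½ +_) (sym (*-assoc (- ½) (pm γ) (pm (par x)))))))

  parity-inner : ∀ {n} N (f : BoolFn n) (H : BoolFn N) γ → (∀ x → H x ≡ γ xor par x) →
    ∀ {a b D} → IsApproxDeg f a → IsApproxDeg H b → IsApproxDeg (f ⊚ H) D → a ℕ.* b ℕ.≤ D
  -- On 0 bits one parity fibre is empty and nothing can be averaged, but then H has approximate
  -- degree 0.
  parity-inner zero f H γ H≡ {a} {D = D} deg-f deg-H deg-fH =
    ℕ.≤-trans (ℕ.*-monoʳ-≤ a (parity-approxDeg≤ H γ H≡ deg-H)) (subst (ℕ._≤ D) (sym (ℕ.*-zeroʳ a)) z≤n)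
  parity-inner {n} (suc k) f H γ H≡ {a} {b} {D} deg-f@((q , _ , q-approx) , _) deg-H ((p , deg-p , p-approx) , _) =
    ℕ.≤-trans (ℕ.*-mono-≤ a≤ (parity-approxDeg≤ H γ H≡ deg-H)) (ℕ.m/n*n≤m D (suc k))
    where
    fibre : ∀ z y → (∀ i → par (λ j → y (combine i j)) ≡ γ xor z i) → (f ⊚ H) y ≡ f z
    fibre z y e = approximates⇒ext f {q} q-approx (λ i → begin
      H (λ j → y (combine i j))         ≡⟨ H≡ (λ j → y (combine i j)) ⟩
      γ xor par (λ j → y (combine i j)) ≡⟨ cong (γ xor_) (e i) ⟩
      γ xor (γ xor z i)                 ≡⟨ xor-assoc γ γ (z i) ⟨
      (γ xor γ) xor z i                 ≡⟨ cong (_xor z i) (xor-same γ) ⟩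
      z i                               ∎)
      where open ≡-Reasoning
    a≤ : a ℕ.≤ D ℕ./ suc k
    a≤ = hasDeg⇒approxDeg≤ f (averageBlocks-eval k γ p deg-p) (λ z → ∣a-b∣≤e-intro (averageBlocks k n (λ i → γ xor z i) (eval p)) ⟦ f z ⟧ oneThird
      (subst (_≤ averageBlocks k n (λ i → γ xor z i) (eval p)) (averageBlocks-const k n (λ i → γ xor z i) (⟦ f z ⟧ - oneThird))
        (averageBlocks-mono k n (λ i → γ xor z i) (λ y e →
          ∣a-b∣≤e⇒b-e≤a (eval p y) ⟦ f z ⟧ oneThird (subst (λ b → ∣ eval p y - ⟦ b ⟧ ∣ ≤ oneThird) (fibre z y e) (p-approx y)))))
      (subst (averageBlocks k n (λ i → γ xor z i) (eval p) ≤_) (averageBlocks-const k n (λ i → γ xor z i) (⟦ f z ⟧ + oneThird))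
        (averageBlocks-mono k n (λ i → γ xor z i) (λ y e →
          ∣a-b∣≤e⇒a≤b+e (eval p y) ⟦ f z ⟧ oneThird (subst (λ b → ∣ eval p y - ⟦ b ⟧ ∣ ≤ oneThird) (fibre z y e) (p-approx y))))))
      deg-f

open FibreAverages

-- Amplifying a weak one-sided margin.

module Amplification where

  open import Data.Rational
  open import Data.Rational.Properties

  -- The upper end is normalised to 1, the fixed point of the amplifying cubic, so that iteration
  -- changes only δ.
  WeaklyApproximable : ∀ {m} → BoolFn m → ℚ → ℕ → Set
  WeaklyApproximable {m} g δ k =
    Σ (Cube m → ℚ) λ h → HasDeg k h × (∀ x → δ ≤ pm (g x) * h x × pm (g x) * h x ≤ 1ℚ)

  3ℚ : ℚ
  3ℚ = ℤ.+ 3 / 1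

  1/63 : ℚ
  1/63 = ℤ.+ 1 / 63

  4/3 : ℚ
  4/3 = ℤ.+ 4 / 3

  -- An odd cubic that maps [0, 1] into itself, fixes 1 and has slope 3/2 at 0.
  cubic : ℚ → ℚ
  cubic v = ½ * (v * (3ℚ + - 1ℚ * (v * v)))

  cubic≤1 : ∀ {v} → 0ℚ ≤ v → v ≤ 1ℚ → cubic v ≤ 1ℚ
  cubic≤1 {v} 0≤v v≤1 = ≤-by-gap (½ * ((1ℚ - v) * (1ℚ - v) * (1ℚ + 1ℚ + v)))
    (0≤* (nonNegative⁻¹ ½) (0≤* (0≤* 0≤1-v 0≤1-v) (0≤+ (nonNegative⁻¹ (1ℚ + 1ℚ)) 0≤v))) (ring v)
    where
    0≤1-v : 0ℚ ≤ 1ℚ - v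
    0≤1-v = x≤y⇒0≤y-x v≤1
    ring : ∀ v → 1ℚ ≡ ½ * (v * (3ℚ + - 1ℚ * (v * v))) + ½ * ((1ℚ - v) * (1ℚ - v) * (1ℚ + 1ℚ + v))
    ring = solve-∀ ℚ-ring

  1-product≥0 : ∀ {u v} → 0ℚ ≤ u → u ≤ 1ℚ → v ≤ 1ℚ → 0ℚ ≤ 1ℚ - u * v
  1-product≥0 {u} {v} 0≤u u≤1 v≤1 = subst (0ℚ ≤_) (ring u v)
    (0≤+ (x≤y⇒0≤y-x u≤1) (0≤* 0≤u (x≤y⇒0≤y-x v≤1)))
    where
    ring : ∀ u v → (1ℚ - u) + u * (1ℚ - v) ≡ 1ℚ - u * v
    ring = solve-∀ ℚ-ring

  -- The first summand of the gap is cubic v - cubic δ, nonnegative by monotonicity on [0, 1]. The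
  -- second is cubic δ - 4/3 δ: for δ ≤ ½ the ratio (3 - δ²)/2 is at least 11/8, which exceeds 4/3
  -- by 1/24.
  cubic-expands : ∀ {δ v} → 0ℚ ≤ δ → δ ≤ ½ → δ ≤ v → v ≤ 1ℚ → 4/3 * δ ≤ cubic v
  cubic-expands {δ} {v} 0≤δ δ≤½ δ≤v v≤1 = ≤-by-gap
    (½ * ((v - δ) * ((1ℚ - v * v) + (1ℚ - v * δ) + (1ℚ - δ * δ))) + ½ * (δ * ((¼ - δ * δ) + 1/12)))
    (0≤+ (0≤* 0≤½ (0≤* (x≤y⇒0≤y-x δ≤v) (0≤+ (0≤+ (1-product≥0 0≤v v≤1 v≤1) (1-product≥0 0≤v v≤1 δ≤1))
           (1-product≥0 0≤δ δ≤1 δ≤1))))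
         (0≤* 0≤½ (0≤* 0≤δ (0≤+ (subst (0ℚ ≤_) (square δ) (0≤* (x≤y⇒0≤y-x δ≤½) (0≤+ 0≤½ 0≤δ))) (nonNegative⁻¹ 1/12)))))
    (ring δ v)
    where
    ¼ 1/12 : ℚ
    ¼ = ℤ.+ 1 / 4
    1/12 = ℤ.+ 1 / 12
    0≤½ : 0ℚ ≤ ½
    0≤½ = nonNegative⁻¹ ½
    0≤v : 0ℚ ≤ v
    0≤v = ≤-trans 0≤δ δ≤v
    δ≤1 : δ ≤ 1ℚ
    δ≤1 = ≤-trans δ≤v v≤1
    square : ∀ δ → (½ - δ) * (½ + δ) ≡ ¼ - δ * δ
    square = solve-∀ ℚ-ring
    ring : ∀ δ v → ½ * (v * (3ℚ + - 1ℚ * (v * v))) ≡ 4/3 * δ +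
      (½ * ((v - δ) * ((1ℚ - v * v) + (1ℚ - v * δ) + (1ℚ - δ * δ))) + ½ * (δ * ((¼ - δ * δ) + 1/12)))
    ring = solve-∀ ℚ-ring

  module _ {m : ℕ} (g : BoolFn m) where

    amplify : ∀ {δ k} → 0ℚ ≤ δ → δ ≤ ½ → WeaklyApproximable g δ k →
              WeaklyApproximable g (4/3 * δ) (3 ℕ.* k)
    amplify {δ} {k} 0≤δ δ≤½ (h , deg , bounds) = cubic ∘ h , degree , bounds′
      where
      degree : HasDeg (3 ℕ.* k) (cubic ∘ h)
      degree = hasDeg-scale ½ (hasDeg-* deg (hasDeg-+ (hasDeg-const 3ℚ) (hasDeg-scale (- 1ℚ)
        (hasDeg-* deg (hasDeg-mono (ℕ.m≤m+n k 0) deg)))))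
      odd⁺ : ∀ v → ½ * ((1ℚ * v) * (3ℚ + - 1ℚ * ((1ℚ * v) * (1ℚ * v)))) ≡ 1ℚ * (½ * (v * (3ℚ + - 1ℚ * (v * v))))
      odd⁺ = solve-∀ ℚ-ring
      odd⁻ : ∀ v → ½ * ((- 1ℚ * v) * (3ℚ + - 1ℚ * ((- 1ℚ * v) * (- 1ℚ * v)))) ≡ - 1ℚ * (½ * (v * (3ℚ + - 1ℚ * (v * v))))
      odd⁻ = solve-∀ ℚ-ring
      odd : ∀ b v → cubic (pm b * v) ≡ pm b * cubic v
      odd true v = odd⁻ v
      odd false v = odd⁺ v
      bounds′ : ∀ x → 4/3 * δ ≤ pm (g x) * cubic (h x) × pm (g x) * cubic (h x) ≤ 1ℚ
      bounds′ x with bounds x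
      ... | lower , upper =
        subst (4/3 * δ ≤_) (odd (g x) (h x)) (cubic-expands 0≤δ δ≤½ lower upper) ,
        subst (_≤ 1ℚ) (odd (g x) (h x)) (cubic≤1 (≤-trans 0≤δ lower) upper)

    amplified : ℕ → ℚ → ℚ
    amplified zero δ = δ
    amplified (suc n) δ = amplified n (4/3 * δ)

    -- A Boolean test, so that for a concrete margin the side condition of every iteration is
    -- settled by evaluation.
    staysSmall : ℕ → ℚ → Bool
    staysSmall zero δ = true
    staysSmall (suc n) δ = (δ ≤ᵇ ½) ∧ staysSmall n (4/3 * δ)

    amplify^ : ∀ n {δ k} → 0ℚ ≤ δ → T (staysSmall n δ) → WeaklyApproximable g δ k →
               WeaklyApproximable g (amplified n δ) (3 ℕ.^ n ℕ.* k)
    amplify^ zero {δ} {k} 0≤δ small weak = subst (WeaklyApproximable g δ) (sym (ℕ.*-identityˡ k)) weak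
    amplify^ (suc n) {δ} {k} 0≤δ small weak =
      subst (WeaklyApproximable g (amplified n (4/3 * δ))) (degree n)
        (amplify^ n (0≤* (nonNegative⁻¹ 4/3) 0≤δ) (proj₂ split) (amplify 0≤δ (≤ᵇ⇒≤ (proj₁ split)) weak))
      where
      split : T (δ ≤ᵇ ½) × T (staysSmall n (4/3 * δ))
      split = Equivalence.to T-∧ small
      degree : ∀ n → 3 ℕ.^ n ℕ.* (3 ℕ.* k) ≡ 3 ℕ.^ suc n ℕ.* k
      degree n = trans (sym (ℕ.*-assoc (3 ℕ.^ n) 3 k)) (cong (ℕ._* k) (ℕ.*-comm (3 ℕ.^ n) 3))

    -- The map h ↦ (1 - h)/2 sends [1/3, 1] to [0, 1/3] and [-1, -1/3] to [2/3, 1].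
    weak-1/3⇒approxDeg≤ : ∀ {δ k b} → oneThird ≤ δ → WeaklyApproximable g δ k → IsApproxDeg g b → b ℕ.≤ k
    weak-1/3⇒approxDeg≤ {δ} 1/3≤δ (h , deg , bounds) = hasDeg⇒approxDeg≤ g
      (hasDeg-scale ½ (hasDeg-+ (hasDeg-const 1ℚ) (hasDeg-scale (- 1ℚ) deg)))
      (λ x → close (g x) (h x) (≤-trans 1/3≤δ (proj₁ (bounds x))) (proj₂ (bounds x)))
      where
      0≤½ : 0ℚ ≤ ½
      0≤½ = nonNegative⁻¹ ½
      low-gap : ∀ {u} → oneThird ≤ u → 0ℚ ≤ ½ * (u - oneThird)
      low-gap lower = 0≤* 0≤½ (x≤y⇒0≤y-x lower)
      high-gap : ∀ {u} → u ≤ 1ℚ → 0ℚ ≤ ½ * (1ℚ - u) + oneThird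
      high-gap upper = 0≤+ (0≤* 0≤½ (x≤y⇒0≤y-x upper)) (nonNegative⁻¹ oneThird)
      ring₁ : ∀ v → oneThird ≡ ½ * (1ℚ + - 1ℚ * v) - 0ℚ + ½ * (1ℚ * v - oneThird)
      ring₁ = solve-∀ ℚ-ring
      ring₂ : ∀ v → oneThird ≡ - (½ * (1ℚ + - 1ℚ * v) - 0ℚ) + (½ * (1ℚ - 1ℚ * v) + oneThird)
      ring₂ = solve-∀ ℚ-ring
      ring₃ : ∀ v → oneThird ≡ ½ * (1ℚ + - 1ℚ * v) - 1ℚ + (½ * (1ℚ - - 1ℚ * v) + oneThird)
      ring₃ = solve-∀ ℚ-ring
      ring₄ : ∀ v → oneThird ≡ - (½ * (1ℚ + - 1ℚ * v) - 1ℚ) + ½ * (- 1ℚ * v - oneThird)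
      ring₄ = solve-∀ ℚ-ring
      close : ∀ b v → oneThird ≤ pm b * v → pm b * v ≤ 1ℚ → ∣ ½ * (1ℚ + - 1ℚ * v) - ⟦ b ⟧ ∣ ≤ oneThird
      close false v lower upper = ∣p∣≤q
        (≤-by-gap (½ * (1ℚ * v - oneThird)) (low-gap lower) (ring₁ v))
        (≤-by-gap (½ * (1ℚ - 1ℚ * v) + oneThird) (high-gap upper) (ring₂ v))
      close true v lower upper = ∣p∣≤q
        (≤-by-gap (½ * (1ℚ - - 1ℚ * v) + oneThird) (high-gap upper) (ring₃ v))
        (≤-by-gap (½ * (- 1ℚ * v - oneThird)) (low-gap lower) (ring₄ v))

  opaque

    -- Eleven triplings of the degree: (4/3)^11 / 63 is about 0.376, while ten steps reach only
    -- about 0.282. Opacity keeps the numeral from being unfolded later.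
    amplification : ℕ
    amplification = 3 ℕ.^ 11

    amplification-nonZero : ℕ.NonZero amplification
    amplification-nonZero = ℕ.m^n≢0 3 11

    weak⇒approxDeg≤ : ∀ {m} (g : BoolFn m) {k b} → WeaklyApproximable g 1/63 k → IsApproxDeg g b →
                      b ℕ.≤ amplification ℕ.* k
    weak⇒approxDeg≤ g weak = weak-1/3⇒approxDeg≤ g (≤ᵇ⇒≤ tt) (amplify^ g 11 (nonNegative⁻¹ 1/63) tt weak)

open Amplification

-- The dual witness from Gordan's alternative.

module Duality where

  open import Data.Rational
  open import Data.Rational.Properties

  -- The rows must form a list in which every sample is found up to propositional equality, hence
  -- vectors instead of functions.
  bitVectors : ∀ n → List (Vec Bool n)
  bitVectors zero = [] ∷ []
  bitVectors (suc n) = map (true ∷_) (bitVectors n) ++ map (false ∷_) (bitVectors n)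

  ∈-bitVectors : ∀ {n} (v : Vec Bool n) → v ∈ bitVectors n
  ∈-bitVectors [] = here refl
  ∈-bitVectors (true ∷ v) = ∈-++⁺ˡ (∈-map⁺ (true ∷_) (∈-bitVectors v))
  ∈-bitVectors {suc n} (false ∷ v) = ∈-++⁺ʳ (map (true ∷_) (bitVectors n)) (∈-map⁺ (false ∷_) (∈-bitVectors v))

  31ℚ 32ℚ 62ℚ 63ℚ : ℚ
  31ℚ = ℤ.+ 31 / 1
  32ℚ = ℤ.+ 32 / 1
  62ℚ = ℤ.+ 62 / 1
  63ℚ = ℤ.+ 63 / 1

  -- A sample of a signed measure on the cube: a sign bit in front of a point.
  Sample : ℕ → Set
  Sample m = Vec Bool (suc m)

  sign : ∀ {m} → Sample m → ℚ
  sign v = pm (head v)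

  point : ∀ {m} → Sample m → Cube m
  point v = lookup (tail v)

  -- 31 − 32 sign is −1 on positive and 63 on negative samples, so `bias` says that the negative
  -- samples have mass 1/64.
  record DualWitness {m : ℕ} (g : BoolFn m) (k : ℕ) : Set where
    field
      weights : FormalSum (Sample m)
      weights-nonNeg : NonNegWeights weights
      mass : ∫ weights (λ _ → 1ℚ) ≡ 1ℚ
      bias : ∫ weights (λ v → 31ℚ + - 32ℚ * sign v) ≡ 0ℚ
      orthogonal : ∀ S → size S ℕ.≤ k → ∫ weights (λ v → sign v * (pm (g (point v)) * monoEval S (point v))) ≡ 0ℚ

  0<⇒nonZero : ∀ {s} → 0ℚ < s → NonZero s
  0<⇒nonZero {s} 0<s = pos⇒nonZero s {{positive 0<s}}

  0<1/ : ∀ {s} (0<s : 0ℚ < s) → 0ℚ < (1/ s) {{0<⇒nonZero 0<s}}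
  0<1/ {s} 0<s = positive⁻¹ _ {{1/pos⇒pos s {{positive 0<s}}}}

  -- For a polynomial h and a scale s the system  s < ±g h < 63 s  (± g = pm ∘ g) is homogeneous:
  -- the coefficient of `nothing` is s, that of `just S` belongs to the monomial S of h.
  module _ {m : ℕ} (g : BoolFn m) (g-ext : Ext g) (k : ℕ) where

    Admissible : Maybe (Subset m) → Set
    Admissible nothing = ⊤
    Admissible (just S) = size S ℕ.≤ k

    row : Sample m → Maybe (Subset m) → ℚ
    row v nothing = 31ℚ + - 32ℚ * sign v
    row v (just S) = sign v * (pm (g (point v)) * monoEval S (point v))

    search : (r : Maybe (Subset m) → ℚ) →
             (∃ λ j → Admissible j × r j ≢ 0ℚ) ⊎ (∀ j → Admissible j → r j ≡ 0ℚ)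
    search r = decide (r nothing ≟ 0ℚ) (anySubset? (λ S → (size S ℕ.≤? k) ×-dec ¬? (r (just S) ≟ 0ℚ)))
      where
      decide : Dec (r nothing ≡ 0ℚ) → Dec (∃ λ S → size S ℕ.≤ k × r (just S) ≢ 0ℚ) →
               (∃ λ j → Admissible j × r j ≢ 0ℚ) ⊎ (∀ j → Admissible j → r j ≡ 0ℚ)
      decide (no r≢0) _ = inj₁ (nothing , tt , r≢0)
      decide (yes _) (yes (S , S≤k , r≢0)) = inj₁ (just S , S≤k , r≢0)
      decide (yes r≡0) (no none) = inj₂ λ where
        nothing _ → r≡0
        (just S) S≤k → decidable-stable (r (just S) ≟ 0ℚ) (λ r≢0 → none (S , S≤k , r≢0))

    open Gordan {I = Sample m} Admissible search

    solution⇒weak : Solution (bitVectors (suc m)) row → WeaklyApproximable g 1/63 k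
    solution⇒weak (p , Qp , positive-rows) = (λ x → c * h x) , hasDeg-scale c (degree p Qp) , bounds
      where
      scalePart : Maybe (Subset m) → ℚ
      scalePart nothing = 1ℚ
      scalePart (just S) = 0ℚ
      polyPart : Cube m → Maybe (Subset m) → ℚ
      polyPart x nothing = 0ℚ
      polyPart x (just S) = monoEval S x
      s : ℚ
      s = ∫ p scalePart
      h : Cube m → ℚ
      h x = ∫ p (polyPart x)
      h-ext : Ext h
      h-ext x≗y = ∫-cong p λ where
        nothing → refl
        (just S) → monoEval-cong S x≗y
      degree : ∀ p → All (λ e → Admissible (proj₂ e)) p → HasDeg k (λ x → ∫ p (polyPart x))
      degree [] [] = hasDeg-const 0ℚ
      degree ((a , nothing) ∷ p) (_ ∷ qs) = hasDeg-+ (hasDeg-const (a * 0ℚ)) (degree p qs)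
      degree ((a , just S) ∷ p) (S≤k ∷ qs) = hasDeg-+ monomial (degree p qs)
        where
        monomial : HasDeg k (λ x → a * monoEval S x)
        monomial = (a , S) ∷ [] , S≤k ∷ [] , λ x → +-identityʳ (a * monoEval S x)
      row-value : ∀ v → ∫ p (row v) ≡ (31ℚ + - 32ℚ * sign v) * s + sign v * pm (g (point v)) * h (point v)
      row-value v = trans (∫-cong p split) (trans
        (∫-+ p (λ j → (31ℚ + - 32ℚ * sign v) * scalePart j) (λ j → sign v * pm (g (point v)) * polyPart (point v) j))
        (cong₂ _+_ (∫-* p (31ℚ + - 32ℚ * sign v) scalePart) (∫-* p (sign v * pm (g (point v))) (polyPart (point v)))))
        where
        ring₁ : ∀ a b → a ≡ a * 1ℚ + b * 0ℚ
        ring₁ = solve-∀ ℚ-ring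
        ring₂ : ∀ a b c d → b * (c * d) ≡ a * 0ℚ + b * c * d
        ring₂ = solve-∀ ℚ-ring
        split : ∀ j → row v j ≡ (31ℚ + - 32ℚ * sign v) * scalePart j + sign v * pm (g (point v)) * polyPart (point v) j
        split nothing = ring₁ (31ℚ + - 32ℚ * sign v) (sign v * pm (g (point v)))
        split (just S) = ring₂ (31ℚ + - 32ℚ * sign v) (sign v) (pm (g (point v))) (monoEval S (point v))
      row-positive : ∀ b x → 0ℚ < (31ℚ + - 32ℚ * pm b) * s + pm b * pm (g x) * h x
      row-positive b x = subst (0ℚ <_)
        (trans (row-value (b ∷ tabulate x))
          (cong₂ (λ u w → (31ℚ + - 32ℚ * pm b) * s + pm b * pm u * w) (g-ext (lookup∘tabulate x)) (h-ext (lookup∘tabulate x))))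
        (All.lookup positive-rows (∈-bitVectors (b ∷ tabulate x)))
      s<gh : ∀ x → s < pm (g x) * h x
      s<gh x = <-by-gap _ (row-positive false x) (ring s (pm (g x)) (h x))
        where
        ring : ∀ s g h → g * h ≡ s + ((31ℚ + - 32ℚ * 1ℚ) * s + 1ℚ * g * h)
        ring = solve-∀ ℚ-ring
      gh<63s : ∀ x → pm (g x) * h x < 63ℚ * s
      gh<63s x = <-by-gap _ (row-positive true x) (ring s (pm (g x)) (h x))
        where
        ring : ∀ s g h → 63ℚ * s ≡ g * h + ((31ℚ + - 32ℚ * - 1ℚ) * s + - 1ℚ * g * h)
        ring = solve-∀ ℚ-ring
      0<s : 0ℚ < s
      -- The two bounds at any single point give s < 63 s. Dividing h by 63 s then places ±g h
      -- between 1/63 and 1.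
      0<s = *-cancelˡ-<-nonNeg 62ℚ (subst (0ℚ <_) (ring s)
        (x<y⇒0<y-x (<-trans (s<gh (λ _ → false)) (gh<63s (λ _ → false)))))
        where
        ring : ∀ s → 63ℚ * s - s ≡ 62ℚ * s
        ring = solve-∀ ℚ-ring
      s⁻¹ c : ℚ
      s⁻¹ = (1/ s) {{0<⇒nonZero 0<s}}
      c = 1/63 * s⁻¹
      0≤c : 0ℚ ≤ c
      0≤c = 0≤* (nonNegative⁻¹ 1/63) (<⇒≤ (0<1/ 0<s))
      s⁻¹s≡1 : s⁻¹ * s ≡ 1ℚ
      s⁻¹s≡1 = *-inverseˡ s {{0<⇒nonZero 0<s}}
      bounds : ∀ x → 1/63 ≤ pm (g x) * (c * h x) × pm (g x) * (c * h x) ≤ 1ℚ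
      bounds x =
        subst₂ _≤_ (trans (ring₁ s⁻¹ s) (cong (1/63 *_) s⁻¹s≡1)) (ring₃ c (pm (g x)) (h x))
          (*-monoˡ-≤-nonNeg c {{nonNegative 0≤c}} (<⇒≤ (s<gh x))) ,
        subst₂ _≤_ (ring₃ c (pm (g x)) (h x)) (trans (ring₂ s⁻¹ s) s⁻¹s≡1)
          (*-monoˡ-≤-nonNeg c {{nonNegative 0≤c}} (<⇒≤ (gh<63s x)))
        where
        ring₁ : ∀ i s → 1/63 * i * s ≡ 1/63 * (i * s)
        ring₁ = solve-∀ ℚ-ring
        ring₂ : ∀ i s → 1/63 * i * (63ℚ * s) ≡ i * s
        ring₂ = solve-∀ ℚ-ring
        ring₃ : ∀ c g h → c * (g * h) ≡ g * (c * h)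
        ring₃ = solve-∀ ℚ-ring

    -- The equation of the scale coordinate `nothing` is `bias`, those of the monomials are
    -- `orthogonal`. Both are homogeneous, so the mass can be normalised afterwards.
    certificate⇒dual : Certificate (bitVectors (suc m)) row → DualWitness g k
    certificate⇒dual (w , w≥0 , _ , 0<w , w⊥) = record
      { weights = scale W⁻¹ w
      ; weights-nonNeg = scale-nonNeg (<⇒≤ (0<1/ 0<w)) w≥0
      ; mass = trans (∫-scale W⁻¹ w (λ _ → 1ℚ)) (*-inverseˡ W {{0<⇒nonZero 0<w}})
      ; bias = vanish nothing tt
      ; orthogonal = λ S → vanish (just S)
      }
      where
      W W⁻¹ : ℚ
      W = ∫ w (λ _ → 1ℚ)
      W⁻¹ = (1/ W) {{0<⇒nonZero 0<w}}
      vanish : ∀ j → Admissible j → ∫ (scale W⁻¹ w) (λ v → row v j) ≡ 0ℚ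
      vanish j Qj = trans (∫-scale W⁻¹ w (λ v → row v j)) (trans (cong (W⁻¹ *_) (w⊥ j Qj)) (*-zeroʳ W⁻¹))

    weak-or-dual : WeaklyApproximable g 1/63 k ⊎ DualWitness g k
    weak-or-dual with gordan (bitVectors (suc m)) row
    ... | inj₁ solution = inj₁ (solution⇒weak solution)
    ... | inj₂ certificate = inj₂ (certificate⇒dual certificate)

open Duality

-- Expansion of the tensor power of the dual witness.

module XorExpansion where

  open import Data.Rational
  open import Data.Rational.Properties

  ∣∫∣≤∫ : ∀ {A : Set} {w : FormalSum A} {f F : A → ℚ} → NonNegWeights w → (∀ a → ∣ f a ∣ ≤ F a) → ∣ ∫ w f ∣ ≤ ∫ w F
  ∣∫∣≤∫ {w = w} {f} {F} w≥0 f≤F = ∣p∣≤q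
    (∫-mono w≥0 (λ a → ≤-trans (p≤∣p∣ (f a)) (f≤F a)))
    (subst (_≤ ∫ w F) (trans (∫-* w (- 1ℚ) f) (sym (ring (∫ w f))))
      (∫-mono w≥0 (λ a → ≤-trans (≤-reflexive (sym (ring (f a)))) (≤-trans (-p≤∣p∣ (f a)) (f≤F a)))))
    where
    ring : ∀ x → - x ≡ - 1ℚ * x
    ring = solve-∀ ℚ-ring

  1/32 : ℚ
  1/32 = ℤ.+ 1 / 32

  -- By Pascal's rule this is binomial(N, j) / 32^j. Once j factors Φ have been met, the remaining
  -- factors stay unexpanded as ±g μ, of norm 1, so each choice of the first j positions is counted
  -- once.
  error : ℕ → ℕ → ℚ
  error N zero = 1ℚ
  error zero (suc j) = 0ℚ
  error (suc N) (suc j) = error N (suc j) + 1/32 * error N j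

  0≤error : ∀ N j → 0ℚ ≤ error N j
  0≤error N zero = nonNegative⁻¹ 1ℚ
  0≤error zero (suc j) = ≤-refl
  0≤error (suc N) (suc j) = 0≤+ (0≤error N (suc j)) (0≤* (nonNegative⁻¹ 1/32) (0≤error N j))

  -- ±g μ = Ψ + Φ for the image μ of `weights` on the cube: Ψ annihilates degree ≤ k and
  -- ‖Φ‖ ≤ 1/32.  Expanding (±g μ)^{⊗N} over subsets, `low N j` collects
  -- the terms with fewer than j factors Φ.
  module Tensor {m : ℕ} (g : BoolFn m) (k : ℕ) (D : DualWitness g k) where

    open DualWitness D

    total Ψ Φ : Sample m → ℚ
    total v = pm (g (point v))
    Ψ v = sign v * pm (g (point v))
    Φ v = (1ℚ - sign v) * pm (g (point v))

    apply : (Sample m → ℚ) → (Cube m → ℚ) → ℚ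
    apply ω h = ∫ weights (λ v → ω v * h (point v))

    apply-cong : ∀ ω {f h} → (∀ x → f x ≡ h x) → apply ω f ≡ apply ω h
    apply-cong ω e = ∫-cong weights (λ v → cong (ω v *_) (e (point v)))

    apply-scale : ∀ ω c f → apply ω (λ x → c * f x) ≡ c * apply ω f
    apply-scale ω c f = trans (∫-cong weights (λ v → ring (ω v) c (f (point v)))) (∫-* weights c (λ v → ω v * f (point v)))
      where
      ring : ∀ a c x → a * (c * x) ≡ c * (a * x)
      ring = solve-∀ ℚ-ring

    apply-∫ : ∀ ω {A : Set} (p : FormalSum A) (f : A → Cube m → ℚ) →
              apply ω (λ x → ∫ p (λ a → f a x)) ≡ ∫ p (λ a → apply ω (f a))
    apply-∫ ω p f = trans
      (∫-cong weights (λ v → sym (∫-* p (ω v) (λ a → f a (point v)))))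
      (∫-swap weights p (λ v a → ω v * f a (point v)))

    bias-mass : ∫ weights (λ v → 1ℚ - sign v) ≡ 1/32
    bias-mass = begin
      ∫ weights (λ v → 1ℚ - sign v)
        ≡⟨ ∫-cong weights (λ v → ring (sign v)) ⟩
      ∫ weights (λ v → 1/32 * (31ℚ + - 32ℚ * sign v) + 1/32 * 1ℚ)
        ≡⟨ ∫-+ weights (λ v → 1/32 * (31ℚ + - 32ℚ * sign v)) (λ _ → 1/32 * 1ℚ) ⟩
      ∫ weights (λ v → 1/32 * (31ℚ + - 32ℚ * sign v)) + ∫ weights (λ _ → 1/32 * 1ℚ)
        ≡⟨ cong₂ _+_ (∫-* weights 1/32 (λ v → 31ℚ + - 32ℚ * sign v)) (∫-* weights 1/32 (λ _ → 1ℚ)) ⟩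
      1/32 * ∫ weights (λ v → 31ℚ + - 32ℚ * sign v) + 1/32 * ∫ weights (λ _ → 1ℚ)
        ≡⟨ cong₂ (λ a b → 1/32 * a + 1/32 * b) bias mass ⟩
      1/32 ∎
      where
      open ≡-Reasoning
      ring : ∀ s → 1ℚ - s ≡ 1/32 * (31ℚ + - 32ℚ * s) + 1/32 * 1ℚ
      ring = solve-∀ ℚ-ring

    apply-bound : ∀ ω τ {ε B h} → (∀ v → ∣ ω v ∣ ≤ τ v) → ∫ weights τ ≡ ε → 0ℚ ≤ B → (∀ x → ∣ h x ∣ ≤ B) →
                  ∣ apply ω h ∣ ≤ ε * B
    apply-bound ω τ {ε} {B} {h} ω≤τ ∫τ≡ε 0≤B h≤B = subst (∣ apply ω h ∣ ≤_)
      (trans (∫-* weights B τ) (trans (*-comm B (∫ weights τ)) (cong (_* B) ∫τ≡ε)))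
      (∣∫∣≤∫ weights-nonNeg pointwise)
      where
      pointwise : ∀ v → ∣ ω v * h (point v) ∣ ≤ B * τ v
      pointwise v = subst₂ _≤_ (sym (∣p*q∣≡∣p∣*∣q∣ (ω v) (h (point v)))) (*-comm (τ v) B)
        (≤-trans (*-monoʳ-≤-nonNeg ∣ h (point v) ∣ {{∣-∣-nonNeg (h (point v))}} (ω≤τ v))
          (*-monoˡ-≤-nonNeg (τ v) {{nonNegative (≤-trans (0≤∣p∣ (ω v)) (ω≤τ v))}} (h≤B (point v))))

    ∣Ψ∣≤1 : ∀ v → ∣ Ψ v ∣ ≤ 1ℚ
    ∣Ψ∣≤1 v = bit (sign-bit) (g (point v))
      where
      sign-bit : Bool
      sign-bit = head v
      bit : ∀ a b → ∣ pm a * pm b ∣ ≤ 1ℚ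
      bit true true = ≤-refl
      bit true false = ≤-refl
      bit false true = ≤-refl
      bit false false = ≤-refl

    ∣Φ∣≤1-sign : ∀ v → ∣ Φ v ∣ ≤ 1ℚ - sign v
    ∣Φ∣≤1-sign v = bit (head v) (g (point v))
      where
      bit : ∀ a b → ∣ (1ℚ - pm a) * pm b ∣ ≤ 1ℚ - pm a
      bit true true = ≤-refl
      bit true false = ≤-refl
      bit false true = ≤-refl
      bit false false = ≤-refl

    all : ∀ N → (Cube (N ℕ.* m) → ℚ) → ℚ
    all zero h = h (λ ())
    all (suc N) h = apply total (λ x → all N (λ y → h (append m x y)))

    low : ∀ N (j : ℕ) → (Cube (N ℕ.* m) → ℚ) → ℚ
    low N zero h = 0ℚ
    low zero (suc j) h = h (λ ())
    low (suc N) (suc j) h = apply Ψ (λ x → low N (suc j) (λ y → h (append m x y)))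
                          + apply Φ (λ x → low N j (λ y → h (append m x y)))

    low-cong : ∀ N j {f h} → (∀ y → f y ≡ h y) → low N j f ≡ low N j h
    low-cong N zero e = refl
    low-cong zero (suc j) e = e (λ ())
    low-cong (suc N) (suc j) e = cong₂ _+_
      (apply-cong Ψ (λ x → low-cong N (suc j) (λ y → e (append m x y))))
      (apply-cong Φ (λ x → low-cong N j (λ y → e (append m x y))))

    low-scale : ∀ N j c f → low N j (λ y → c * f y) ≡ c * low N j f
    low-scale N zero c f = sym (*-zeroʳ c)
    low-scale zero (suc j) c f = refl
    low-scale (suc N) (suc j) c f = trans
      (cong₂ _+_
        (trans (apply-cong Ψ (λ x → low-scale N (suc j) c (λ y → f (append m x y))))
          (apply-scale Ψ c (λ x → low N (suc j) (λ y → f (append m x y)))))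
        (trans (apply-cong Φ (λ x → low-scale N j c (λ y → f (append m x y))))
          (apply-scale Φ c (λ x → low N j (λ y → f (append m x y))))))
      (sym (*-distribˡ-+ c _ _))

    low-∫ : ∀ N j {A : Set} (p : FormalSum A) (f : A → Cube (N ℕ.* m) → ℚ) →
            low N j (λ y → ∫ p (λ a → f a y)) ≡ ∫ p (λ a → low N j (f a))
    low-∫ N zero p f = sym (∫-zero (All.universal (λ _ → refl) p))
    low-∫ zero (suc j) p f = refl
    low-∫ (suc N) (suc j) p f = trans
      (cong₂ _+_
        (trans (apply-cong Ψ (λ x → low-∫ N (suc j) p (λ a y → f a (append m x y))))
          (apply-∫ Ψ p (λ a x → low N (suc j) (λ y → f a (append m x y)))))
        (trans (apply-cong Φ (λ x → low-∫ N j p (λ a y → f a (append m x y))))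
          (apply-∫ Φ p (λ a x → low N j (λ y → f a (append m x y))))))
      (sym (∫-+ p _ _))

    -- e is the least number of factors Ψ in a term of low N j, so a monomial that survives has
    -- more than k variables in each of e blocks.
    low-monomial : ∀ N (j e : ℕ) → suc N ≡ j ℕ.+ e → (S : Subset (N ℕ.* m)) → size S ℕ.< e ℕ.* suc k →
                   low N j (monoEval S) ≡ 0ℚ
    low-monomial N zero e _ S _ = refl
    low-monomial zero (suc j) zero _ S ()
    low-monomial zero (suc j) (suc e) eq S _ with () ← trans (ℕ.suc-injective eq) (ℕ.+-suc j e)
    low-monomial (suc N) (suc j) zero _ S ()
    low-monomial (suc N) (suc j) (suc e) eq S S< with splitAtᵛ m S
    ... | S₁ , S₂ , refl = trans (cong₂ _+_ Ψ-term Φ-term) refl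
      where
      factor : ∀ ω i → apply ω (λ x → low N i (λ y → monoEval (S₁ ++ᵛ S₂) (append m x y))) ≡
                       low N i (monoEval S₂) * apply ω (monoEval S₁)
      factor ω i = trans
        (apply-cong ω (λ x → trans (low-cong N i (λ y → monoEval-append m S₁ S₂ x y))
          (trans (low-scale N i (monoEval S₁ x) (monoEval S₂)) (*-comm (monoEval S₁ x) (low N i (monoEval S₂))))))
        (apply-scale ω (low N i (monoEval S₂)) (monoEval S₁))
      S₁+S₂< : size S₁ ℕ.+ size S₂ ℕ.< suc e ℕ.* suc k
      S₁+S₂< = subst (ℕ._< suc e ℕ.* suc k) (size-++ S₁ S₂) S<
      vanishˡ : ∀ u v → u ≡ 0ℚ → u * v ≡ 0ℚ
      vanishˡ u v e = trans (cong (_* v) e) (*-zeroˡ v)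
      Φ-term : apply Φ (λ x → low N j (λ y → monoEval (S₁ ++ᵛ S₂) (append m x y))) ≡ 0ℚ
      Φ-term = trans (factor Φ j) (vanishˡ (low N j (monoEval S₂)) (apply Φ (monoEval S₁))
        (low-monomial N j (suc e) (ℕ.suc-injective eq) S₂
          (ℕ.≤-<-trans (ℕ.m≤n+m (size S₂) (size S₁)) S₁+S₂<)))
      annihilated : size S₁ ℕ.≤ k → apply Ψ (monoEval S₁) ≡ 0ℚ
      annihilated S₁≤k = trans
        (∫-cong weights (λ v → *-assoc (sign v) (pm (g (point v))) (monoEval S₁ (point v)))) (orthogonal S₁ S₁≤k)
      Ψ-term : apply Ψ (λ x → low N (suc j) (λ y → monoEval (S₁ ++ᵛ S₂) (append m x y))) ≡ 0ℚ
      Ψ-term = trans (factor Ψ (suc j)) (by-size (size S₁ ℕ.≤? k))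
        where
        by-size : Dec (size S₁ ℕ.≤ k) → low N (suc j) (monoEval S₂) * apply Ψ (monoEval S₁) ≡ 0ℚ
        by-size (yes S₁≤k) = trans (cong (low N (suc j) (monoEval S₂) *_) (annihilated S₁≤k))
          (*-zeroʳ (low N (suc j) (monoEval S₂)))
        by-size (no S₁≰k) = vanishˡ (low N (suc j) (monoEval S₂)) (apply Ψ (monoEval S₁))
          (low-monomial N (suc j) e (trans (ℕ.suc-injective eq) (ℕ.+-suc j e)) S₂
            (ℕ.+-cancelˡ-< (suc k) (size S₂) (e ℕ.* suc k)
              (ℕ.≤-<-trans (ℕ.+-monoˡ-≤ (size S₂) (ℕ.≰⇒> S₁≰k)) S₁+S₂<)))

    low-vanishes : ∀ N j e {d f} → suc N ≡ j ℕ.+ e → d ℕ.< e ℕ.* suc k → HasDeg d f → low N j f ≡ 0ℚ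
    low-vanishes N j e eq d< (p , deg , ep) = trans (low-cong N j (λ y → sym (ep y)))
      (trans (low-∫ N j p monoEval) (∫-zero (All.map (λ {t} s → low-monomial N j e eq (proj₂ t) (ℕ.≤-<-trans s d<)) deg)))

    all-bound : ∀ N {B h} → 0ℚ ≤ B → (∀ y → ∣ h y ∣ ≤ B) → ∣ all N h ∣ ≤ B
    all-bound zero 0≤B h≤B = h≤B (λ ())
    all-bound (suc N) {B} {h} 0≤B h≤B = subst (∣ all (suc N) h ∣ ≤_) (*-identityˡ B)
      (apply-bound total (λ _ → 1ℚ) (λ v → ∣pm∣≤1 (g (point v))) mass 0≤B
        (λ x → all-bound N 0≤B (λ y → h≤B (append m x y))))
      where
      ∣pm∣≤1 : ∀ b → ∣ pm b ∣ ≤ 1ℚ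
      ∣pm∣≤1 true = ≤-refl
      ∣pm∣≤1 false = ≤-refl

    -- Since `total` = Ψ + Φ, on the first block the difference is Ψ applied to the difference for
    -- `suc j` plus Φ applied to that for j. The norms 1 and 1/32 reproduce the recursion of
    -- `error`.
    all-low : ∀ N j {B h} → 0ℚ ≤ B → (∀ y → ∣ h y ∣ ≤ B) → ∣ all N h - low N j h ∣ ≤ error N j * B
    all-low N zero {B} {h} 0≤B h≤B = subst₂ (λ u w → ∣ u ∣ ≤ w)
      (sym (+-identityʳ (all N h))) (sym (*-identityˡ B)) (all-bound N 0≤B h≤B)
    all-low zero (suc j) {B} {h} 0≤B h≤B = ≤-reflexive (trans
      (cong ∣_∣ (+-inverseʳ (h (λ ())))) (sym (*-zeroˡ B)))
    all-low (suc N) (suc j) {B} {h} 0≤B h≤B =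
      subst₂ (λ u w → ∣ u ∣ ≤ w) (sym difference) (ring-bound (error N (suc j)) (error N j) B)
        (≤-trans (∣p+q∣≤∣p∣+∣q∣ (apply Ψ (λ x → Δ (suc j) x)) (apply Φ (λ x → Δ j x)))
          (+-mono-≤
            (apply-bound Ψ (λ _ → 1ℚ) ∣Ψ∣≤1 mass (0≤* (0≤error N (suc j)) 0≤B)
              (λ x → all-low N (suc j) 0≤B (λ y → h≤B (append m x y))))
            (apply-bound Φ (λ v → 1ℚ - sign v) ∣Φ∣≤1-sign bias-mass (0≤* (0≤error N j) 0≤B)
              (λ x → all-low N j 0≤B (λ y → h≤B (append m x y))))))
      where
      a : Cube m → ℚ
      a x = all N (λ y → h (append m x y))
      l : ℕ → Cube m → ℚ
      l i x = low N i (λ y → h (append m x y))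
      Δ : ℕ → Cube m → ℚ
      Δ i x = a x - l i x
      ring-bound : ∀ s t B → 1ℚ * (s * B) + 1/32 * (t * B) ≡ (s + 1/32 * t) * B
      ring-bound = solve-∀ ℚ-ring
      ring : ∀ s γ a u v → s * γ * (a - u) + (1ℚ - s) * γ * (a - v) ≡ γ * a + - 1ℚ * (s * γ * u + (1ℚ - s) * γ * v)
      ring = solve-∀ ℚ-ring
      ring-neg : ∀ u w → u - w ≡ u + - 1ℚ * w
      ring-neg = solve-∀ ℚ-ring
      difference : all (suc N) h - low (suc N) (suc j) h ≡ apply Ψ (Δ (suc j)) + apply Φ (Δ j)
      difference = begin
        apply total a - (apply Ψ (l (suc j)) + apply Φ (l j))
          ≡⟨ ring-neg (apply total a) (apply Ψ (l (suc j)) + apply Φ (l j)) ⟩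
        apply total a + - 1ℚ * (apply Ψ (l (suc j)) + apply Φ (l j))
          ≡⟨ cong (λ u → apply total a + - 1ℚ * u) (sym (∫-+ weights (λ v → Ψ v * l (suc j) (point v)) (λ v → Φ v * l j (point v)))) ⟩
        apply total a + - 1ℚ * ∫ weights (λ v → Ψ v * l (suc j) (point v) + Φ v * l j (point v))
          ≡⟨ cong (apply total a +_) (sym (∫-* weights (- 1ℚ) (λ v → Ψ v * l (suc j) (point v) + Φ v * l j (point v)))) ⟩
        apply total a + ∫ weights (λ v → - 1ℚ * (Ψ v * l (suc j) (point v) + Φ v * l j (point v)))
          ≡⟨ ∫-+ weights (λ v → total v * a (point v)) (λ v → - 1ℚ * (Ψ v * l (suc j) (point v) + Φ v * l j (point v))) ⟨
        ∫ weights (λ v → total v * a (point v) + - 1ℚ * (Ψ v * l (suc j) (point v) + Φ v * l j (point v)))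
          ≡⟨ ∫-cong weights (λ v → ring (sign v) (pm (g (point v))) (a (point v)) (l (suc j) (point v)) (l j (point v))) ⟨
        ∫ weights (λ v → Ψ v * Δ (suc j) (point v) + Φ v * Δ j (point v))
          ≡⟨ ∫-+ weights (λ v → Ψ v * Δ (suc j) (point v)) (λ v → Φ v * Δ j (point v)) ⟩
        apply Ψ (Δ (suc j)) + apply Φ (Δ j) ∎
        where open ≡-Reasoning

    all-scale : ∀ N c f → all N (λ y → c * f y) ≡ c * all N f
    all-scale zero c f = refl
    all-scale (suc N) c f = trans
      (apply-cong total (λ x → all-scale N c (λ y → f (append m x y))))
      (apply-scale total c (λ x → all N (λ y → f (append m x y))))

    -- `all N h` is the mean, under N independent samples, of h times the product of the signs of g,
    -- and that product is the sign of their parity.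
    all-lower : Ext g → ∀ N {c h} → (∀ z → c ≤ pm (par (λ i → g (λ j → z (combine {N} {m} i j)))) * h z) → c ≤ all N h
    all-lower g-ext zero {c} {h} c≤ = subst (c ≤_) (*-identityˡ (h (λ ()))) (c≤ (λ ()))
    all-lower g-ext (suc N) {c} {h} c≤ = subst (_≤ all (suc N) h)
      (trans (∫-* weights c (λ _ → 1ℚ)) (trans (cong (c *_) mass) (*-identityʳ c)))
      (∫-mono weights-nonNeg (λ v → subst₂ _≤_ (sym (*-identityʳ c)) (all-scale N (total v) (λ y → h (append m (point v) y)))
        (all-lower g-ext N (λ z → subst (c ≤_) (split (point v) z) (c≤ (append m (point v) z))))))
      where
      ring : ∀ a b u → a * b * u ≡ b * (a * u)
      ring = solve-∀ ℚ-ring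
      values : Cube (N ℕ.* m) → Cube N
      values z i = g (λ j → z (combine i j))
      split : ∀ x z →
        pm (par (λ i → g (λ j → append m x z (combine {suc N} {m} i j)))) * h (append m x z) ≡
        pm (par (λ i → g (λ j → z (combine {N} {m} i j)))) * (pm (g x) * h (append m x z))
      split x z = trans
        (cong (λ b → pm b * h (append m x z)) (cong₂ _xor_ (g-ext (append-↑ˡ m x z))
          (par-cong {N} (λ i → g-ext (λ j → append-↑ʳ m x z (combine i j))))))
        (trans (cong (_* h (append m x z)) (pm-xor (g x) (par (values z)))) (ring (pm (g x)) (pm (par (values z))) (h (append m x z))))

open XorExpansion

-- Numerical estimates and the outer parity.

module Bounds where

  open import Data.Rational
  open import Data.Rational.Properties

  2ℚ 1/8 5/3 : ℚ
  2ℚ = ℤ.+ 2 / 1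
  1/8 = ℤ.+ 1 / 8
  5/3 = ℤ.+ 5 / 3

  pow : ℚ → ℕ → ℚ
  pow x zero = 1ℚ
  pow x (suc n) = x * pow x n

  0≤pow : ∀ {x} → 0ℚ ≤ x → ∀ n → 0ℚ ≤ pow x n
  0≤pow 0≤x zero = nonNegative⁻¹ 1ℚ
  0≤pow 0≤x (suc n) = 0≤* 0≤x (0≤pow 0≤x n)

  1≤pow-2 : ∀ n → 1ℚ ≤ pow 2ℚ n
  1≤pow-2 zero = ≤-refl
  1≤pow-2 (suc n) = ≤-trans (1≤pow-2 n) (≤-by-gap (pow 2ℚ n) (0≤pow (nonNegative⁻¹ 2ℚ) n) (ring (pow 2ℚ n)))
    where
    ring : ∀ x → 2ℚ * x ≡ x + x
    ring = solve-∀ ℚ-ring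

  error≤pow : ∀ N j → error N j ≤ pow 2ℚ N * pow 1/32 j
  error≤pow N zero = subst (1ℚ ≤_) (sym (*-identityʳ (pow 2ℚ N))) (1≤pow-2 N)
  error≤pow zero (suc j) = subst (0ℚ ≤_) (sym (*-identityˡ (1/32 * pow 1/32 j))) (0≤pow (nonNegative⁻¹ 1/32) (suc j))
  error≤pow (suc N) (suc j) = subst (error (suc N) (suc j) ≤_) (ring (pow 2ℚ N) (pow 1/32 j))
    (+-mono-≤ (error≤pow N (suc j)) (*-monoˡ-≤-nonNeg 1/32 (error≤pow N j)))
    where
    ring : ∀ x y → x * (1/32 * y) + 1/32 * (x * y) ≡ 2ℚ * x * (1/32 * y)
    ring = solve-∀ ℚ-ring

  -- With h ≤ j the left side is at most 4^j / 32^j. It is used with h and j the two halves of N,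
  -- after the binomial in `error` is bounded by 2^N.
  balanced-pow : ∀ {h j} → h ℕ.≤ j → pow 2ℚ (h ℕ.+ j) * pow 1/32 j ≤ pow 1/8 j
  balanced-pow {zero} {zero} z≤n = ≤-refl
  balanced-pow {zero} {suc j} z≤n = ≤-by-gap (1/16 * pow 1/8 j + 1/16 * (pow 1/8 j - pow 2ℚ j * pow 1/32 j))
    (0≤+ (0≤* (nonNegative⁻¹ 1/16) (0≤pow (nonNegative⁻¹ 1/8) j))
         (0≤* (nonNegative⁻¹ 1/16) (x≤y⇒0≤y-x (balanced-pow {zero} {j} z≤n))))
    (ring (pow 2ℚ j) (pow 1/32 j) (pow 1/8 j))
    where
    1/16 : ℚ
    1/16 = ℤ.+ 1 / 16
    ring : ∀ x y z → 1/8 * z ≡ 2ℚ * x * (1/32 * y) + (1/16 * z + 1/16 * (z - x * y))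
    ring = solve-∀ ℚ-ring
  balanced-pow {suc h} {suc j} (s≤s h≤j) = subst (_≤ pow 1/8 (suc j))
    (trans (ring (pow 2ℚ (h ℕ.+ j)) (pow 1/32 j))
      (cong (λ n → 2ℚ * pow 2ℚ n * (1/32 * pow 1/32 j)) (sym (ℕ.+-suc h j))))
    (*-monoˡ-≤-nonNeg 1/8 (balanced-pow h≤j))
    where
    ring : ∀ x y → 1/8 * (x * y) ≡ 2ℚ * (2ℚ * x) * (1/32 * y)
    ring = solve-∀ ℚ-ring

  pow-1/8≤1 : ∀ n → pow 1/8 n ≤ 1ℚ
  pow-1/8≤1 zero = ≤-refl
  pow-1/8≤1 (suc n) = ≤-trans (*-monoˡ-≤-nonNeg 1/8 (pow-1/8≤1 n)) (≤ᵇ⇒≤ tt)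

  -- A positive number of blocks gives j ≥ 1, and one factor 1/8 is enough.
  error≤1/8 : ∀ n → error (suc n) ⌈ suc n /2⌉ ≤ 1/8
  error≤1/8 n = ≤-trans (error≤pow (suc n) j) (≤-trans
    (subst (λ N → pow 2ℚ N * pow 1/32 j ≤ pow 1/8 j) (ℕ.⌊n/2⌋+⌈n/2⌉≡n (suc n)) (balanced-pow (ℕ.⌊n/2⌋≤⌈n/2⌉ (suc n))))
    (*-monoˡ-≤-nonNeg 1/8 (pow-1/8≤1 ⌊ n /2⌋)))
    where
    j : ℕ
    j = ⌈ suc n /2⌉

  -- The map v ↦ 1 - 2v takes bits to signs and an error of 1/3 to 2/3, leaving a margin of 1/3 here
  -- and the bound 5/3 in `bit-bound`.
  bit-lower : ∀ b v → ∣ v - ⟦ b ⟧ ∣ ≤ oneThird → oneThird ≤ pm b * (1ℚ + - 2ℚ * v)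
  bit-lower true v close = ≤-by-gap (2ℚ * (v - (1ℚ - oneThird)))
    (0≤* (nonNegative⁻¹ 2ℚ) (x≤y⇒0≤y-x (∣a-b∣≤e⇒b-e≤a v 1ℚ oneThird close))) (ring v)
    where
    ring : ∀ v → - 1ℚ * (1ℚ + - 2ℚ * v) ≡ oneThird + 2ℚ * (v - (1ℚ - oneThird))
    ring = solve-∀ ℚ-ring
  bit-lower false v close = ≤-by-gap (2ℚ * (0ℚ + oneThird - v))
    (0≤* (nonNegative⁻¹ 2ℚ) (x≤y⇒0≤y-x (∣a-b∣≤e⇒a≤b+e v 0ℚ oneThird close))) (ring v)
    where
    ring : ∀ v → 1ℚ * (1ℚ + - 2ℚ * v) ≡ oneThird + 2ℚ * (0ℚ + oneThird - v)
    ring = solve-∀ ℚ-ring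

  bit-bound : ∀ c b v → ∣ v - ⟦ b ⟧ ∣ ≤ oneThird → ∣ pm c * (1ℚ + - 2ℚ * v) ∣ ≤ 5/3
  bit-bound c b v close = subst (λ u → ∣ u ∣ ≤ 5/3) (ring (pm c) ⟦ b ⟧ v)
    (≤-trans (∣p+q∣≤∣p∣+∣q∣ (pm c * (1ℚ + - 2ℚ * ⟦ b ⟧)) (pm c * - 2ℚ * (v - ⟦ b ⟧)))
      (+-mono-≤ (unit c b) (subst (_≤ 2ℚ * oneThird) (sym (trans (∣p*q∣≡∣p∣*∣q∣ (pm c * - 2ℚ) (v - ⟦ b ⟧)) (cong (_* ∣ v - ⟦ b ⟧ ∣) (two c))))
        (*-monoˡ-≤-nonNeg 2ℚ close))))
    where
    ring : ∀ c b v → c * (1ℚ + - 2ℚ * b) + c * - 2ℚ * (v - b) ≡ c * (1ℚ + - 2ℚ * v)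
    ring = solve-∀ ℚ-ring
    unit : ∀ c b → ∣ pm c * (1ℚ + - 2ℚ * ⟦ b ⟧) ∣ ≤ 1ℚ
    unit true true = ≤-refl
    unit true false = ≤-refl
    unit false true = ≤-refl
    unit false false = ≤-refl
    two : ∀ c → ∣ pm c * - 2ℚ ∣ ≡ 2ℚ
    two true = refl
    two false = refl

  dual⇒xor-lower-bound : ∀ n {m k γ} (H : BoolFn (suc n)) (g : BoolFn m) → Ext g → DualWitness g k →
    (∀ x → H x ≡ γ xor par x) → ∀ (p : Poly (suc n ℕ.* m)) {D} → DegLe p D → Approximates p (H ⊚ g) →
    suc ⌊ suc n /2⌋ ℕ.* suc k ℕ.≤ D
  dual⇒xor-lower-bound n {m} {k} {γ} H g g-ext dual H≡ p {D} deg approx = ℕ.≮⇒≥ impossible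
    where
    open Tensor g k dual
    N j : ℕ
    N = suc n
    j = ⌈ N /2⌉
    -- Passing to ±1 values and multiplying by `pm γ` removes the outer negation, so that P is
    -- compared with the plain parity of the values of g.
    P : Cube (N ℕ.* m) → ℚ
    P z = pm γ * (1ℚ + - 2ℚ * eval p z)
    P-deg : HasDeg D P
    P-deg = hasDeg-scale (pm γ) (hasDeg-+ (hasDeg-const 1ℚ) (hasDeg-scale (- 2ℚ) (p , deg , λ _ → refl)))
    P-bound : ∀ z → ∣ P z ∣ ≤ 5/3
    P-bound z = bit-bound γ ((H ⊚ g) z) (eval p z) (approx z)
    P-lower : ∀ z → oneThird ≤ pm (par (λ i → g (λ j → z (combine {N} {m} i j)))) * P z
    P-lower z = subst (oneThird ≤_) rearranged (bit-lower ((H ⊚ g) z) (eval p z) (approx z))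
      where
      values : Cube N
      values i = g (λ j → z (combine {N} {m} i j))
      ring : ∀ a b c → a * b * c ≡ b * (a * c)
      ring = solve-∀ ℚ-ring
      rearranged : pm (H values) * (1ℚ + - 2ℚ * eval p z) ≡ pm (par values) * P z
      rearranged = trans (cong (_* (1ℚ + - 2ℚ * eval p z)) (trans (cong pm (H≡ values)) (pm-xor γ (par values))))
        (ring (pm γ) (pm (par values)) (1ℚ + - 2ℚ * eval p z))
    impossible : D ℕ.< suc ⌊ N /2⌋ ℕ.* suc k → ⊥
    -- If `low N j P` vanishes, the correlation is at least 1/3 and at most 1/8 · 5/3 = 5/24.
    impossible D< = ≤⇒≤ᵇ {oneThird} {1/8 * 5/3} (≤-trans (all-lower g-ext N P-lower) (≤-trans (p≤∣p∣ (all N P))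
      (≤-trans (subst (λ u → ∣ u ∣ ≤ error N j * 5/3) all-P (all-low N j (nonNegative⁻¹ 5/3) P-bound))
        (*-monoʳ-≤-nonNeg 5/3 (error≤1/8 n)))))
      where
      -- Fewer than j = ⌈N/2⌉ factors Φ leave at least ⌊N/2⌋ + 1 factors Ψ.
      blocks : suc N ≡ j ℕ.+ suc ⌊ N /2⌋
      blocks = trans (cong suc (trans (sym (ℕ.⌊n/2⌋+⌈n/2⌉≡n N)) (ℕ.+-comm ⌊ N /2⌋ j))) (sym (ℕ.+-suc j ⌊ N /2⌋))
      all-P : all N P - low N j P ≡ all N P
      all-P = trans (cong (λ u → all N P - u) (low-vanishes N j (suc ⌊ N /2⌋) blocks D< P-deg)) (+-identityʳ (all N P))

  instance
    amplification≢0 : ℕ.NonZero amplification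
    amplification≢0 = amplification-nonZero

  -- The factor `amplification` is lost in the degree of g, and 2 because only ⌊N/2⌋ + 1 of the N
  -- blocks are sure to contribute.
  constant : ℕ
  constant = 2 ℕ.* amplification

  instance
    constant≢0 : ℕ.NonZero constant
    constant≢0 = ℕ.m*n≢0 2 amplification

  -- A weak approximant of degree b / `amplification` would amplify to an approximant of degree at
  -- most b, below the minimum `suc b`.
  approxDeg⇒dual : ∀ {m b} (g : BoolFn m) → IsApproxDeg g (suc b) → DualWitness g (b ℕ./ amplification)
  approxDeg⇒dual {m} {b} g deg-g@((q , _ , q-approx) , _) =
    [ (λ weak → ⊥-elim (ℕ.<-irrefl refl (ℕ.≤-trans (weak⇒approxDeg≤ g weak deg-g) below))) , (λ dual → dual) ]′
      (weak-or-dual g (approximates⇒ext g {q} q-approx) (b ℕ./ amplification))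
    where
    below : amplification ℕ.* (b ℕ./ amplification) ℕ.≤ b
    below = subst (ℕ._≤ b) (ℕ.*-comm (b ℕ./ amplification) amplification) (ℕ.m/n*n≤m b amplification)

  m<[1+m/n]*n : ∀ m n .{{_ : ℕ.NonZero n}} → m ℕ.< suc (m ℕ./ n) ℕ.* n
  m<[1+m/n]*n m n = subst (ℕ._< suc (m ℕ./ n) ℕ.* n) (sym (ℕ.m≡m%n+[m/n]*n m n))
    (ℕ.+-monoˡ-< (m ℕ./ n ℕ.* n) (ℕ.m%n<n m n))

  n≤2*[1+⌊n/2⌋] : ∀ n → n ℕ.≤ 2 ℕ.* suc ⌊ n /2⌋
  n≤2*[1+⌊n/2⌋] zero = z≤n
  n≤2*[1+⌊n/2⌋] (suc zero) = s≤s z≤n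
  n≤2*[1+⌊n/2⌋] (suc (suc n)) = subst (suc (suc n) ℕ.≤_) (ring ⌊ n /2⌋) (s≤s (s≤s (n≤2*[1+⌊n/2⌋] n)))
    where
    ring : ∀ h → suc (suc (2 ℕ.* suc h)) ≡ 2 ℕ.* suc (suc h)
    ring = solve-ℕ

  parity-outer : ∀ N {m} (H : BoolFn N) (g : BoolFn m) γ → (∀ x → H x ≡ γ xor par x) →
    ∀ {a b D} → IsApproxDeg H a → IsApproxDeg g b → IsApproxDeg (H ⊚ g) D → a ℕ.* b ℕ.≤ constant ℕ.* D
  parity-outer N H g γ H≡ {a} {zero} {D} _ _ _ = subst (ℕ._≤ constant ℕ.* D) (sym (ℕ.*-zeroʳ a)) z≤n
  parity-outer zero H g γ H≡ {a} {suc b} {D} deg-H _ _ =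
    ℕ.≤-trans (ℕ.*-monoˡ-≤ (suc b) (parity-approxDeg≤ H γ H≡ deg-H)) z≤n
  parity-outer (suc n) H g γ H≡ {a} {suc b} {D} deg-H deg-g@((q , _ , q-approx) , _) ((p , deg-p , p-approx) , _) =
    combine-bounds amplification (parity-approxDeg≤ H γ H≡ deg-H) (m<[1+m/n]*n b amplification)
      (dual⇒xor-lower-bound n {γ = γ} H g (approximates⇒ext g {q} q-approx) (approxDeg⇒dual g deg-g) H≡ p deg-p p-approx)
    where
    ring : ∀ e l K → (2 ℕ.* e) ℕ.* (l ℕ.* K) ≡ (2 ℕ.* K) ℕ.* (e ℕ.* l)
    ring = solve-ℕ
    combine-bounds : ∀ K {l} → a ℕ.≤ suc n → suc b ℕ.≤ l ℕ.* K → suc ⌊ suc n /2⌋ ℕ.* l ℕ.≤ D →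
                     a ℕ.* suc b ℕ.≤ (2 ℕ.* K) ℕ.* D
    combine-bounds K {l} a≤ b≤ l≤ = begin
      a ℕ.* suc b                                 ≤⟨ ℕ.*-mono-≤ (ℕ.≤-trans a≤ (n≤2*[1+⌊n/2⌋] (suc n))) b≤ ⟩
      (2 ℕ.* suc ⌊ suc n /2⌋) ℕ.* (l ℕ.* K)       ≡⟨ ring (suc ⌊ suc n /2⌋) l K ⟩
      (2 ℕ.* K) ℕ.* (suc ⌊ suc n /2⌋ ℕ.* l)       ≤⟨ ℕ.*-monoʳ-≤ (2 ℕ.* K) l≤ ⟩
      (2 ℕ.* K) ℕ.* D                             ∎
      where open ℕ.≤-Reasoning

  -- Among unnormalised fractions the claim is a cross-multiplied integer inequality, free of the
  -- gcd in the normal form.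
  ℕ≤⇒ℚ≤ : ∀ M .{{_ : ℕ.NonZero M}} {x d} → x ℕ.≤ M ℕ.* d → (ℤ.+ 1 / M) * ℕtoℚ x ≤ ℕtoℚ d
  ℕ≤⇒ℚ≤ (suc M) {x} {d} x≤ = toℚᵘ-cancel-≤ (begin
    toℚᵘ ((ℤ.+ 1 / suc M) * ℕtoℚ x)
      ≃⟨ toℚᵘ-homo-* (ℤ.+ 1 / suc M) (ℕtoℚ x) ⟩
    toℚᵘ (ℤ.+ 1 / suc M) ℚᵘ.* toℚᵘ (ℕtoℚ x)
      ≃⟨ ℚᵘ.*-cong (toℚᵘ-fromℚᵘ (ℚᵘ.mkℚᵘ (ℤ.+ 1) M)) (toℚᵘ-fromℚᵘ (ℚᵘ.mkℚᵘ (ℤ.+ x) 0)) ⟩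
    ℚᵘ.mkℚᵘ (ℤ.+ 1) M ℚᵘ.* ℚᵘ.mkℚᵘ (ℤ.+ x) 0
      ≤⟨ ℚᵘ.*≤* cross ⟩
    ℚᵘ.mkℚᵘ (ℤ.+ d) 0
      ≃⟨ ℚᵘ.≃-sym (toℚᵘ-fromℚᵘ (ℚᵘ.mkℚᵘ (ℤ.+ d) 0)) ⟩
    toℚᵘ (ℕtoℚ d) ∎)
    where
    open ℚᵘ.≤-Reasoning
    cross : (ℤ.+ 1 ℤ.* ℤ.+ x) ℤ.* ℤ.+ 1 ℤ.≤ ℤ.+ d ℤ.* ℤ.+ (suc M ℕ.* 1)
    cross = subst₂ ℤ._≤_
      (sym (trans (ℤ.*-identityʳ (ℤ.+ 1 ℤ.* ℤ.+ x)) (ℤ.*-identityˡ (ℤ.+ x))))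
      (trans (cong ℤ.+_ (trans (ℕ.*-comm (suc M) d) (cong (d ℕ.*_) (sym (ℕ.*-identityʳ (suc M)))))) (ℤ.pos-* d (suc M ℕ.* 1)))
      (ℤ.+≤+ x≤)

open Bounds

open import Data.Nat using (ℕ; _*_; _^_; _≤_; _<_)
open import Data.Nat.Logarithm using (⌈log₂_⌉)
open import Data.Rational using (ℚ; 0ℚ)
import Data.Rational as ℚ
import Data.Rational.Properties as ℚ
open import Data.Product using (Σ; _×_)

theorem26 : Σ ℕ λ C → Σ ℚ λ c → (0ℚ ℚ.< c) ×
    (∀ (t d m : ℕ) (Amp : BoolFn t) (g : BoolFn m) → 1 ≤ d → FullSignDeg Amp
    → C * ⌈log₂ (t ^ d) ⌉ ≤ t
    → ∀ (a b D : ℕ) → IsApproxDeg (Amp ^^ d) a → IsApproxDeg g b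
    → IsApproxDeg ((Amp ^^ d) ⊚ g) D
    → c ℚ.* ℕtoℚ (a * b) ℚ.≤ ℕtoℚ D)
    × (∀ (t d n : ℕ) (Amp : BoolFn t) (f : BoolFn n) → 1 ≤ d → FullSignDeg Amp
    → C * ⌈log₂ n ⌉ ≤ t
    → ∀ (a b D : ℕ) → IsApproxDeg f a → IsApproxDeg (Amp ^^ d) b
    → IsApproxDeg (f ⊚ (Amp ^^ d)) D
    → c ℚ.* ℕtoℚ (a * b) ℚ.≤ ℕtoℚ D)
theorem26 =
  0 , ℤ.+ 1 ℚ./ constant , 0<1/constant ,
  (λ t d m Amp g _ full _ a b D deg-Amp deg-g deg-comp →
    let (γ , Amp^d≡) = amp-parity Amp full d
    in ℕ≤⇒ℚ≤ constant (parity-outer (t ^ d) (Amp ^^ d) g γ Amp^d≡ deg-Amp deg-g deg-comp)) ,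
  (λ t d n Amp f _ full _ a b D deg-f deg-Amp deg-comp →
    let (γ , Amp^d≡) = amp-parity Amp full d
    in ℕ≤⇒ℚ≤ constant (ℕ.≤-trans (parity-inner (t ^ d) f (Amp ^^ d) γ Amp^d≡ deg-f deg-Amp deg-comp)
         (ℕ.m≤n*m D constant)))
  where
  0<1/constant : 0ℚ ℚ.< ℤ.+ 1 ℚ./ constant
  0<1/constant = ℚ.positive⁻¹ (ℤ.+ 1 ℚ./ constant) {{ℚ.normalize-pos 1 constant}}
  amp-parity : ∀ {t} (Amp : BoolFn t) → FullSignDeg Amp → ∀ d → Σ Bool λ γ → ∀ x → (Amp ^^ d) x ≡ γ xor par x
  amp-parity Amp full d = let (β , Amp≡) = fullSignDeg⇒parity Amp full in parity-^^ Amp {β} Amp≡ d
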